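{- Let $n\ge 3$, let $k_1,k_2,k_3$ be nonnegative integers, and let $\ell,t$ be integers. With $D_n(\ell,t,k_1,k_2,k_3)$ as defined in the context, we have $$A_{\ell+1}D_n(\ell+1,t,k_1,k_2,k_3)+A_{\ell}D_n(\ell,t,k_1,k_2,k_3)+\bar A_{\ell}D_n(\ell,t-1,k_1,k_2,k_3)+A_{\ell-1}D_n(\ell-1,t,k_1,k_2,k_3)+\bar A_{\ell-1}D_n(\ell-1,t-1,k_1,k_2,k_3)=0,$$ where the five coefficients are $$A_{\ell+1}=(\ell+1)\Big(k_2-k_1-3+\tfrac{k_3}{2}(2n-2-\ell)\Big),$$ $$A_{\ell}=t-n+(\ell+1)\Big(k_2-k_1-2+\tfrac{k_3}{2}(2n-2-\ell)\Big)-(n-\ell)\Big(k_2-2+\tfrac{k_3}{2}(n-1-\ell)\Big),$$ $$\bar A_{\ell}=-\Big(t-n+1+(\ell+1)\Big(k_2-k_1-2+\tfrac{k_3}{2}(2n-2-\ell)\Big)\Big),$$ $$A_{\ell-1}=-\bar A_{\ell-1}=-(n-\ell)\Big(k_2-1+\tfrac{k_3}{2}(n-1-\ell)\Big).$$ (The subscripts on $A,\bar A$ are only names of these five quantities; they are not values of a single function at shifted arguments.)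
   Context: Put $y_i=1-x_i$ for $1\le i\le n$ and $Y=y_1+\cdots+y_n$. For an integer $\ell$, $e_\ell[Y-y_n]$ denotes the $\ell$-th elementary symmetric polynomial in $y_1,\dots,y_{n-1}$, with $e_0=1$ and $e_\ell[Y-y_n]=0$ if $\ell<0$ or $\ell>n-1$. Define $$\Phi_n(\ell,t,k_1,k_2,k_3)=\frac{e_\ell[Y-y_n]\prod_{i=1}^{n}x_i^{k_1}\prod_{i=1}^{n-1}(x_i-x_n)}{x_n^{t}\prod_{i=1}^{n}(1-x_i)^{k_2}\prod_{1\le i<j\le n}(x_i-x_j)^{k_3}},\qquad D_n(\ell,t,k_1,k_2,k_3)=\operatorname*{Res}_{\boldsymbol{x}}\Phi_n(\ell,t,k_1,k_2,k_3),$$ where $\operatorname*{Res}_{\boldsymbol{x}}$ means the coefficient of $x_1^{ -1}x_2^{ -1}\cdots x_n^{ -1}$ in the Laurent series expansion according to $1>x_1>x_2>\cdots>x_n>0$, i.e. $\frac1{1-x_i}=\sum_{k\ge0}x_i^k$ and, for $i<j$, $\frac1{x_i-x_j}=x_i^{ -1}\sum_{k\ge0}(x_j/x_i)^k$. -}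

module Defs where

open import Algebra.Bundles.Raw using (RawRing)
import Algebra.Definitions.RawSemiring as RawSemiringDefs
open import Data.Fin.Base as Fin using (Fin; fromℕ; inject₁; toℕ)
open import Data.Fin.Properties using (_<?_; toℕ-inject₁; ≤fromℕ)
open import Data.Fin.Relation.Unary.Top using (view; ‵fromℕ; ‵inject₁)
open import Data.Integer.Base as ℤ using (ℤ; +_; -[1+_]; 0ℤ; 1ℤ; -1ℤ)
open import Data.List.Base using (List; []; _∷_; _++_; map; foldr)
open import Data.Nat.Base as ℕ using (ℕ; zero; suc; _∸_)
open import Data.Nat.Properties using (≤⇒≯)
open import Data.Rational.Base as Rat using (ℚ; +-*-rawRing)
open import Data.Vec.Functional using (Vector; toList)
open import Level using (0ℓ)
open import Relation.Binary.PropositionalEquality.Core using (subst₂)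
open import Relation.Nullary.Decidable.Core using (yes; no)
open import Relation.Nullary.Negation.Core using (contradiction-irr)

private
  variable
    n : ℕ

------------------------------------------------------------------------
-- Formal Laurent series

-- laurent v a is the series  Σ_{k ≥ 0} a k · X^(v + k).  The first
-- coefficients may vanish, so v is only a lower bound for the order and
-- a series has many representations; the equality _≈_ of laurentRing
-- compares the coefficients of all powers of X.

record Laurent (A : Set) : Set where
  constructor laurent
  field
    start  : ℤ
    coeffs : ℕ → A

open Laurent public

module _ (R : RawRing 0ℓ 0ℓ) where
  open RawRing R
  open RawSemiringDefs rawSemiring using (sum)

  nth : (ℕ → Carrier) → ℤ → Carrier
  nth a (+ k)    = a k
  nth a -[1+ _ ] = 0#

  δ : Carrier → ℕ → Carrier
  δ c zero    = c
  δ c (suc _) = 0#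

  coeff : ℤ → Laurent Carrier → Carrier
  coeff z f = nth (coeffs f) (z ℤ.- start f)

  monomial : Carrier → ℤ → Laurent Carrier
  monomial c z = laurent z (δ c)

  laurentRing : RawRing 0ℓ 0ℓ
  laurentRing = record
    { Carrier = Laurent Carrier
    ; _≈_     = λ f g → ∀ z → coeff z f ≈ coeff z g
    ; _+_     = λ f g → let v = start f ℤ.⊓ start g in
                  laurent v λ k → coeff (v ℤ.+ + k) f + coeff (v ℤ.+ + k) g
    ; _*_     = λ f g → laurent (start f ℤ.+ start g) λ k →
                  sum {suc k} λ i → coeffs f (toℕ i) * coeffs g (k ∸ toℕ i)
    ; -_      = λ f → laurent (start f) λ k → - coeffs f k
    ; 0#      = monomial 0# 0ℤ
    ; 1#      = monomial 1# 0ℤ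
    }

------------------------------------------------------------------------
-- Products over pairs and elementary symmetric polynomials

-- All sublists of a given length.
choose : {A : Set} → ℕ → List A → List (List A)
choose zero    _        = [] ∷ []
choose (suc k) []       = []
choose (suc k) (a ∷ as) = map (a ∷_) (choose k as) ++ choose (suc k) as

module _ (R : RawRing 0ℓ 0ℓ) where
  open RawRing R
  open RawSemiringDefs rawSemiring using (product)

  factor< : ((i j : Fin n) → .(i Fin.< j) → Carrier) → Fin n → Fin n → Carrier
  factor< f i j with i <? j
  ... | yes i<j = f i j i<j
  ... | no  _   = 1#

  -- ∏_{1 ≤ i < j ≤ n} f i j
  product< : ((i j : Fin n) → .(i Fin.< j) → Carrier) → Carrier
  product< f = product λ i → product λ j → factor< f i j

  -- e_ℓ of the entries of v; it vanishes for ℓ > n since then there are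
  -- no sublists of length ℓ.
  e : ℤ → Vector Carrier n → Carrier
  e (+ k)    v = foldr _+_ 0# (map (foldr _*_ 1#) (choose k (toList v)))
  e -[1+ _ ] v = 0#

------------------------------------------------------------------------
-- Iterated Laurent series ℚ((x₁))((x₂))⋯((xₙ))

-- The last variable is the outermost one: this is the ring in which
-- rational functions are expanded according to 1 > x₁ > x₂ > ⋯ > xₙ > 0.

iterated : ℕ → RawRing 0ℓ 0ℓ
iterated zero    = +-*-rawRing
iterated (suc n) = laurentRing (iterated n)

Series : ℕ → Set
Series n = RawRing.Carrier (iterated n)

const : Series n → Series (suc n)
const {n} f = monomial (iterated n) f 0ℤ

-- The coefficient of x₁⁻¹ x₂⁻¹ ⋯ xₙ⁻¹.
Res : Series n → ℚ
Res {zero}  f = f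
Res {suc n} f = Res {n} (coeff (iterated n) -1ℤ f)

-- The variables are x₁ , … , xₙ, with xᵢ at the index i - 1 of Fin n.

x^ : Fin n → ℤ → Series n
x^ {suc n} i z with view i
... | ‵fromℕ     = monomial (iterated n) (RawRing.1# (iterated n)) z
... | ‵inject₁ i = const {n} (x^ i z)

x : Fin n → Series n
x i = x^ i 1ℤ

-- The expansion of 1 / (1 - xᵢ), that is Σ_{k ≥ 0} xᵢ^k.
1/⟨1-x_⟩ : Fin n → Series n
1/⟨1-x_⟩ {suc n} i with view i
... | ‵fromℕ     = laurent 0ℤ λ _ → RawRing.1# (iterated n)
... | ‵inject₁ i = const {n} 1/⟨1-x i ⟩

-- The expansion of 1 / (xᵢ - xⱼ) for i < j, that is
-- xᵢ⁻¹ Σ_{k ≥ 0} (xⱼ / xᵢ)^k = Σ_{k ≥ 0} xᵢ^(-1-k) xⱼ^k.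
1/⟨x_-x_⟩ : (i j : Fin n) → .(i Fin.< j) → Series n
1/⟨x_-x_⟩ {suc n} i j i<j with view i | view j
... | ‵fromℕ     | _          = contradiction-irr i<j (≤⇒≯ (≤fromℕ j))
... | ‵inject₁ i | ‵fromℕ     = laurent 0ℤ λ k → x^ i -[1+ k ]
... | ‵inject₁ i | ‵inject₁ j = const {n} (1/⟨x i -x j ⟩
                                  (subst₂ ℕ._<_ (toℕ-inject₁ i) (toℕ-inject₁ j) i<j))

y : Fin n → Series n
y {n} i = 1# + - x i
  where open RawRing (iterated n)

------------------------------------------------------------------------
-- Φₙ and its residue Dₙ

Φ : ∀ n .{{_ : ℕ.NonZero n}} (ℓ t : ℤ) (k₁ k₂ k₃ : ℕ) → Series n
Φ n@(suc m) ℓ t k₁ k₂ k₃ =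
    e (iterated n) ℓ (λ (i : Fin m) → y (inject₁ i))
  * product (λ (i : Fin n) → x i ^ k₁)
  * product (λ (i : Fin m) → x (inject₁ i) + - x last)
  * x^ last (ℤ.- t)
  * product (λ (i : Fin n) → 1/⟨1-x i ⟩ ^ k₂)
  * product< (iterated n) {n} (λ i j i<j → 1/⟨x i -x j ⟩ i<j ^ k₃)
  where
  open RawRing (iterated n)
  open RawSemiringDefs rawSemiring using (product; _^_)
  last : Fin n
  last = fromℕ m

D : ∀ n .{{_ : ℕ.NonZero n}} (ℓ t : ℤ) (k₁ k₂ k₃ : ℕ) → ℚ
D n ℓ t k₁ k₂ k₃ = Res {n} (Φ n ℓ t k₁ k₂ k₃)

------------------------------------------------------------------------
-- The coefficients of the recurrence

ι : ℤ → ℚ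
ι z = z Rat./ 1

-- A₊, A₀, Ā₀, A₋, Ā₋ stand for A_{ℓ+1}, A_ℓ, Ā_ℓ, A_{ℓ-1}, Ā_{ℓ-1}.
module Coefficients (n : ℕ) (ℓ t : ℤ) (k₁ k₂ k₃ : ℕ) where
  open Rat using (_+_; _*_; _-_; -_; _/_)
  private
    N K₁ K₂ : ℤ
    N  = + n
    K₁ = + k₁
    K₂ = + k₂

  A₊ A₀ Ā₀ A₋ Ā₋ : ℚ
  A₊ = ι (ℓ ℤ.+ 1ℤ) * (ι (K₂ ℤ.- K₁ ℤ.- + 3) + + k₃ / 2 * ι (+ 2 ℤ.* N ℤ.- + 2 ℤ.- ℓ))
  A₀ = ι (t ℤ.- N)
     + ι (ℓ ℤ.+ 1ℤ) * (ι (K₂ ℤ.- K₁ ℤ.- + 2) + + k₃ / 2 * ι (+ 2 ℤ.* N ℤ.- + 2 ℤ.- ℓ))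
     - ι (N ℤ.- ℓ) * (ι (K₂ ℤ.- + 2) + + k₃ / 2 * ι (N ℤ.- 1ℤ ℤ.- ℓ))
  Ā₀ = - (ι (t ℤ.- N ℤ.+ 1ℤ)
     + ι (ℓ ℤ.+ 1ℤ) * (ι (K₂ ℤ.- K₁ ℤ.- + 2) + + k₃ / 2 * ι (+ 2 ℤ.* N ℤ.- + 2 ℤ.- ℓ)))
  A₋ = - (ι (N ℤ.- ℓ) * (ι (K₂ ℤ.- 1ℤ) + + k₃ / 2 * ι (N ℤ.- 1ℤ ℤ.- ℓ)))
  Ā₋ = - A₋

{-# OPTIONS --safe #-}

-- Write yᵢ = 1 - xᵢ, let eⁱ_k be the k-th elementary symmetric polynomial in
-- the y's other than yᵢ, let θᵢ = xᵢ ∂/∂xᵢ, and let F be Φₙ without its factor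
-- e_ℓ[Y - yₙ].  Since Res (θᵢ f) = - Res f, the residue of
-- Σᵢ (θᵢ + 1)(yᵢ eⁱ_ℓ F) vanishes.  The derivation V = Σᵢ yᵢ eⁱ_ℓ θᵢ multiplies
-- every factor of F by a polynomial: V xᵢ = yᵢ eⁱ_ℓ xᵢ,
-- V (1 - xᵢ) = - xᵢ eⁱ_ℓ (1 - xᵢ), and V (xₐ - x_b) = hₐ_b (xₐ - x_b) with
-- hₐ_b = yₐ e^{ab}_ℓ + y_b e^b_ℓ - e^{ab}_ℓ.  So the sum above is a polynomial
-- times F.  By Σᵢ yᵢ eⁱ_ℓ = (ℓ + 1) e_{ℓ+1} and Σᵢ eⁱ_ℓ = (n - ℓ) e_ℓ, applied
-- once more to the y's other than y_b for Σₐ hₐ_b, this polynomial is minus the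
-- combination of e_{ℓ+1}, e_ℓ, e_{ℓ-1} of y₁ , … , yₙ₋₁ in the recurrence.

module Submission where

open import Defs
open import Algebra.Bundles using (CommutativeRing)
open import Algebra.Bundles.Raw using (RawRing)
import Algebra.Definitions.RawSemiring as RawSemiringDefs
import Algebra.Morphism.Construct.Composition as Composition
import Algebra.Morphism.Construct.Identity as Identity
open import Algebra.Morphism.Structures using (IsRingHomomorphism)
import Algebra.Properties.CommutativeSemigroup as CommutativeSemigroupProperties
import Algebra.Properties.Ring as RingProperties
import Algebra.Properties.Semiring.Sum as SemiringSum
import Algebra.Solver.Ring as RingSolver
open import Algebra.Solver.Ring.AlmostCommutativeRing using (fromCommutativeRing; _-Raw-AlmostCommutative⟶_)
open import Algebra.Structures using (IsCommutativeRing)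
open import Data.Bool.Base using (if_then_else_; true; false)
open import Data.Empty using (⊥-elim)
open import Data.Fin.Base as Fin using (Fin; zero; suc; toℕ; fromℕ; inject₁)
open import Data.Fin.Properties using (_<?_; _≟_; <-cmp; ≤fromℕ; toℕ-inject₁)
open import Data.Fin.Relation.Unary.Top using (view; ‵fromℕ; ‵inject₁)
open import Data.Integer.Base as ℤ using (ℤ; +_; -[1+_]; 0ℤ; 1ℤ; -1ℤ)
import Data.Integer.Properties as ℤ
open import Data.Integer.Tactic.RingSolver using (solve-∀)
open import Data.List.Base using (List; []; _∷_; _++_; map; foldr)
open import Data.Maybe.Base using (Maybe; just; nothing)
open import Data.Nat.Base as ℕ using (ℕ; zero; suc; _∸_; NonZero)
open import Data.Nat.Properties using (≤⇒≯)
open import Data.Product.Base using (_,_)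
open import Data.Rational.Base as ℚ using (ℚ; 0ℚ; 1ℚ; ½)
import Data.Rational.Properties as ℚ
import Data.Rational.Unnormalised.Base as ℚᵘ
import Data.Rational.Unnormalised.Properties as ℚᵘ
open import Data.Sum.Base using (inj₁; inj₂)
open import Data.Vec.Functional using (Vector; head; tail; toList)
open import Level using (0ℓ)
open import Relation.Binary.Definitions using (tri<; tri≈; tri>)
open import Relation.Binary.PropositionalEquality.Core as ≡ using (_≡_; _≢_)
import Relation.Binary.Reasoning.Setoid as SetoidReasoning
open import Relation.Nullary.Decidable using (dec-true; dec-false)
open import Relation.Nullary.Decidable.Core using (does; yes; no)
open import Relation.Nullary.Negation.Core using (contradiction-irr)

-- Laurent series over a commutative ring

-- The coefficients yᵢ eⁱ_ℓ of V are chosen for divisibility. The factor yᵢ makes V (1 - xᵢ)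
-- divisible by 1 - xᵢ. Moreover eⁱ_ℓ is a polynomial in yᵢ whose coefficients are symmetric in all
-- the y's, so V xₐ - V x_b vanishes where xₐ = x_b, and hₐ_b is the quotient. As eⁱ_ℓ is free of
-- xᵢ, θᵢ meets only the factor yᵢ of its own coefficient. Separating yₙ in e_{ℓ+1} and e_ℓ of all
-- the y's leaves factors yₙ = 1 - xₙ, and multiplying F by xₙ lowers t by one: hence the terms with
-- t - 1. Since h is symmetric, its sum over i < j is half of the sum over all i ≠ j: hence k₃/2.
-- The computation takes place in an arbitrary commutative ring over ℚ with derivations and given
-- inverses, where a factor such as xₐ - x_b may be inverted but not cancelled at will. Deleting a
-- variable is therefore division of the generating function by 1 + yᵢ T, which is always possible,
-- and logarithmic derivatives are a relation free of division. The argument is run for ℓ ≥ 0; for ℓ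
-- < 0 each term of the recurrence is zero.

i+j-i≡j : ∀ i j → i ℤ.+ j ℤ.- i ≡ j
i+j-i≡j = solve-∀

i+[j-i]≡j : ∀ i j → i ℤ.+ (j ℤ.- i) ≡ j
i+[j-i]≡j = solve-∀

i-j≡-[1+k]⇒i<j : ∀ i j {k} → i ℤ.- j ≡ -[1+ k ] → i ℤ.< j
i-j≡-[1+k]⇒i<j i j eq = ≡.subst₂ ℤ._<_ (i+[j-i]≡j j i) (ℤ.+-identityʳ j)
  (≡.subst (λ d → j ℤ.+ d ℤ.< j ℤ.+ 0ℤ) (≡.sym eq) (ℤ.+-monoʳ-< j ℤ.-<+))

-- Derivations of a commutative ring

record Derivation (A : CommutativeRing 0ℓ 0ℓ) : Set where
  open CommutativeRing A
  field
    ∂       : Carrier → Carrier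
    ∂-cong  : ∀ {f g} → f ≈ g → ∂ f ≈ ∂ g
    ∂-+     : ∀ f g → ∂ (f + g) ≈ ∂ f + ∂ g
    leibniz : ∀ f g → ∂ (f * g) ≈ ∂ f * g + f * ∂ g

  open RingProperties ring using (+-identityʳ-unique; +-inverseʳ-unique)

  ∂-0 : ∂ 0# ≈ 0#
  ∂-0 = +-identityʳ-unique _ _ (trans (sym (∂-+ 0# 0#)) (∂-cong (+-identityˡ 0#)))

  ∂-1 : ∂ 1# ≈ 0#
  ∂-1 = +-identityʳ-unique _ _ (trans (+-cong (sym (*-identityʳ _)) (sym (*-identityˡ _)))
    (trans (sym (leibniz 1# 1#)) (∂-cong (*-identityˡ 1#))))

  ∂-neg : ∀ f → ∂ (- f) ≈ - ∂ f
  ∂-neg f = +-inverseʳ-unique _ _ (trans (sym (∂-+ f (- f))) (trans (∂-cong (-‿inverseʳ f)) ∂-0))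

module LaurentSeries (A : CommutativeRing 0ℓ 0ℓ) where
  open CommutativeRing A
  open RingProperties ring using (-0#≈0#)
  open SemiringSum semiring using (sum)
  open CommutativeSemigroupProperties +-commutativeSemigroup using (interchange)
  open SetoidReasoning setoid hiding (start)

  private
    module L = RawRing (laurentRing rawRing)
    Stream : Set
    Stream = ℕ → Carrier
    tailˢ : Stream → Stream
    tailˢ a k = a (suc k)
    variable
      a b c a′ b′ : Stream

  open L public using () renaming (Carrier to Carrierᴸ; _≈_ to infix 4 _≈ᴸ_; _+_ to infixl 6 _+ᴸ_; _*_ to infixl 7 _*ᴸ_)

  -- Convolution of coefficient streams

  0+0≈0 : 0# ≈ 0# + 0#
  0+0≈0 = sym (+-identityˡ 0#)

  -- As `sum` peels off its first term, `conv a b (suc k)` unfolds by computation to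
  -- `a 0 * b (suc k) + conv (tailˢ a) b k`. The inductions on convolutions rest on this recursion.
  conv : Stream → Stream → Stream
  conv a b k = sum {suc k} λ i → a (toℕ i) * b (k ∸ toℕ i)

  conv-head : ∀ a b → conv a b 0 ≈ a 0 * b 0
  conv-head a b = +-identityʳ _

  conv-congʳ : (∀ k → a k ≈ a′ k) → ∀ b k → conv a b k ≈ conv a′ b k
  conv-congʳ p b zero    = +-congʳ (*-congʳ (p 0))
  conv-congʳ p b (suc k) = +-cong (*-congʳ (p 0)) (conv-congʳ (λ j → p (suc j)) b k)

  conv-distribʳ : ∀ a b c k → conv (λ j → a j + b j) c k ≈ conv a c k + conv b c k
  conv-distribʳ a b c zero    = trans (+-cong (distribʳ _ _ _) 0+0≈0) (interchange _ _ _ _)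
  conv-distribʳ a b c (suc k) =
    trans (+-cong (distribʳ _ _ _) (conv-distribʳ (tailˢ a) (tailˢ b) c k)) (interchange _ _ _ _)

  conv-scaleˡ : ∀ s a b k → conv (λ j → s * a j) b k ≈ s * conv a b k
  conv-scaleˡ s a b zero    = trans (+-cong (*-assoc _ _ _) (sym (zeroʳ s))) (sym (distribˡ _ _ _))
  conv-scaleˡ s a b (suc k) =
    trans (+-cong (*-assoc _ _ _) (conv-scaleˡ s (tailˢ a) b k)) (sym (distribˡ _ _ _))

  conv-assoc : ∀ a b c k → conv (conv a b) c k ≈ conv a (conv b c) k
  conv-assoc a b c zero = +-congʳ (begin
    (a 0 * b 0 + 0#) * c 0 ≈⟨ *-congʳ (+-identityʳ _) ⟩
    a 0 * b 0 * c 0        ≈⟨ *-assoc _ _ _ ⟩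
    a 0 * (b 0 * c 0)      ≈⟨ *-congˡ (+-identityʳ _) ⟨
    a 0 * (b 0 * c 0 + 0#) ∎)
  conv-assoc a b c (suc k) = begin
    conv a b 0 * c (suc k) + conv (λ j → a 0 * b (suc j) + conv (tailˢ a) b j) c k
      ≈⟨ +-cong (trans (*-congʳ (conv-head a b)) (*-assoc _ _ _))
                (conv-distribʳ (λ j → a 0 * b (suc j)) (conv (tailˢ a) b) c k) ⟩
    a 0 * (b 0 * c (suc k)) + (conv (λ j → a 0 * b (suc j)) c k + conv (conv (tailˢ a) b) c k)
      ≈⟨ +-congˡ (+-cong (conv-scaleˡ (a 0) (tailˢ b) c k) (conv-assoc (tailˢ a) b c k)) ⟩
    a 0 * (b 0 * c (suc k)) + (a 0 * conv (tailˢ b) c k + conv (tailˢ a) (conv b c) k)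
      ≈⟨ +-assoc _ _ _ ⟨
    a 0 * (b 0 * c (suc k)) + a 0 * conv (tailˢ b) c k + conv (tailˢ a) (conv b c) k
      ≈⟨ +-congʳ (distribˡ _ _ _) ⟨
    a 0 * conv b c (suc k) + conv (tailˢ a) (conv b c) k ∎

  -- Splits off the last term instead of the first. Commutativity needs both ends, since exchanging
  -- the factors reverses the sum.
  conv-suc : ∀ a b k → conv a b (suc k) ≈ conv a (tailˢ b) k + a (suc k) * b 0
  conv-suc a b zero    = sym (trans (+-congʳ (+-identityʳ _)) (+-congˡ (sym (+-identityʳ _))))
  conv-suc a b (suc k) = trans (+-congˡ (conv-suc (tailˢ a) b k)) (sym (+-assoc _ _ _))

  conv-comm : ∀ a b k → conv a b k ≈ conv b a k
  conv-comm a b zero    = +-congʳ (*-comm _ _)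
  conv-comm a b (suc k) = begin
    a 0 * b (suc k) + conv (tailˢ a) b k ≈⟨ +-cong (*-comm _ _) (conv-comm (tailˢ a) b k) ⟩
    b (suc k) * a 0 + conv b (tailˢ a) k ≈⟨ +-comm _ _ ⟩
    conv b (tailˢ a) k + b (suc k) * a 0 ≈⟨ conv-suc b a k ⟨
    conv b a (suc k)                    ∎

  conv-zeroˡ : (∀ k → a k ≈ 0#) → ∀ b k → conv a b k ≈ 0#
  conv-zeroˡ p b zero    = trans (+-identityʳ _) (trans (*-congʳ (p 0)) (zeroˡ _))
  conv-zeroˡ p b (suc k) = trans
    (+-cong (trans (*-congʳ (p 0)) (zeroˡ _)) (conv-zeroˡ (λ j → p (suc j)) b k)) (+-identityʳ _)

  conv-δ : ∀ s b k → conv (δ rawRing s) b k ≈ s * b k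
  conv-δ s b zero    = +-identityʳ _
  conv-δ s b (suc k) = trans (+-congˡ (conv-zeroˡ (λ _ → refl) b k)) (+-identityʳ _)

  shift₁ : Stream → Stream
  shift₁ a zero    = 0#
  shift₁ a (suc k) = a k

  -- Prepending `m` zeros and lowering the start by `m` represents the same series
  -- (`laurent-shift`); this brings series with different starts to a common one.
  shift : ℕ → Stream → Stream
  shift zero    a = a
  shift (suc m) a = shift₁ (shift m a)

  conv-shift₁ : ∀ a b k → conv (shift₁ a) b k ≈ shift₁ (conv a b) k
  conv-shift₁ a b zero    = trans (+-identityʳ _) (zeroˡ _)
  conv-shift₁ a b (suc k) = trans (+-congʳ (zeroˡ _)) (+-identityˡ _)

  shift₁-cong : (∀ k → a k ≈ b k) → ∀ k → shift₁ a k ≈ shift₁ b k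
  shift₁-cong p zero    = refl
  shift₁-cong p (suc k) = p k

  conv-shift : ∀ m a b k → conv (shift m a) b k ≈ shift m (conv a b) k
  conv-shift zero    a b k = refl
  conv-shift (suc m) a b k =
    trans (conv-shift₁ (shift m a) b k) (shift₁-cong (conv-shift m a b) k)

  -- Coefficients and representations of Laurent series

  coeffᴸ : ℤ → Carrierᴸ → Carrier
  coeffᴸ = coeff rawRing

  nth-cong : (∀ k → a k ≈ b k) → ∀ w → nth rawRing a w ≈ nth rawRing b w
  nth-cong p (+ k)    = p k
  nth-cong p -[1+ _ ] = refl

  nth-+ : ∀ a b w → nth rawRing (λ k → a k + b k) w ≈ nth rawRing a w + nth rawRing b w
  nth-+ a b (+ k)    = refl
  nth-+ a b -[1+ _ ] = 0+0≈0

  nth-shift₁ : ∀ a w → nth rawRing (shift₁ a) (1ℤ ℤ.+ w) ≡ nth rawRing a w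
  nth-shift₁ a (+ k)          = ≡.refl
  nth-shift₁ a -[1+ zero ]    = ≡.refl
  nth-shift₁ a -[1+ (suc k) ] = ≡.refl

  nth-shift : ∀ m a w → nth rawRing (shift m a) (+ m ℤ.+ w) ≡ nth rawRing a w
  nth-shift zero    a w = ≡.cong (nth rawRing a) (ℤ.+-identityˡ w)
  nth-shift (suc m) a w = ≡.trans
    (≡.cong (nth rawRing (shift (suc m) a)) (ℤ.+-assoc 1ℤ (+ m) w))
    (≡.trans (nth-shift₁ (shift m a) (+ m ℤ.+ w)) (nth-shift m a w))

  coeff-start : ∀ f k → coeffᴸ (start f ℤ.+ + k) f ≡ coeffs f k
  coeff-start f k = ≡.cong (nth rawRing (coeffs f)) (i+j-i≡j (start f) (+ k))

  coeff-below : ∀ z f → z ℤ.< start f → coeffᴸ z f ≡ 0#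
  coeff-below z f z<v with z ℤ.- start f in eq
  ... | -[1+ _ ] = ≡.refl
  ... | + k      with () ← ℤ.≤⇒≯ (ℤ.0≤i-j⇒j≤i (≡.subst (0ℤ ℤ.≤_) (≡.sym eq) (ℤ.+≤+ ℕ.z≤n))) z<v

  coeff-+ : ∀ z f g → coeffᴸ z (f +ᴸ g) ≈ coeffᴸ z f + coeffᴸ z g
  coeff-+ z f g with z ℤ.- (start f ℤ.⊓ start g) in eq
  ... | + k      = reflexive (≡.cong (λ w → coeffᴸ w f + coeffᴸ w g)
                     (≡.trans (≡.cong (λ w → v ℤ.+ w) (≡.sym eq)) (i+[j-i]≡j v z)))
    where
    v : ℤ
    v = start f ℤ.⊓ start g
  ... | -[1+ k ] = trans 0+0≈0 (reflexive (≡.sym (≡.cong₂ _+_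
                     (coeff-below z f (ℤ.<-≤-trans z<v (ℤ.i⊓j≤i (start f) (start g))))
                     (coeff-below z g (ℤ.<-≤-trans z<v (ℤ.i⊓j≤j (start f) (start g)))))))
    where
    v : ℤ
    v = start f ℤ.⊓ start g
    z<v : z ℤ.< v
    z<v = i-j≡-[1+k]⇒i<j z v eq

  coeff-neg : ∀ z f → coeffᴸ z (L.- f) ≈ - coeffᴸ z f
  coeff-neg z f with z ℤ.- start f
  ... | + k      = refl
  ... | -[1+ _ ] = sym -0#≈0#

  coeff-0 : ∀ z → coeffᴸ z L.0# ≈ 0#
  coeff-0 z with z ℤ.- 0ℤ
  ... | + zero    = refl
  ... | + (suc _) = refl
  ... | -[1+ _ ]  = refl

  laurent-cong : ∀ {v w} → v ≡ w → (∀ k → a k ≈ b k) → laurent v a ≈ᴸ laurent w b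
  laurent-cong {v = v} ≡.refl p z = nth-cong p (z ℤ.- v)

  laurent-shift : ∀ m v a → laurent (v ℤ.- + m) (shift m a) ≈ᴸ laurent v a
  laurent-shift m v a z = reflexive (≡.trans
    (≡.cong (nth rawRing (shift m a)) (regroup z v (+ m))) (nth-shift m a (z ℤ.- v)))
    where
    regroup : ∀ z v m → z ℤ.- (v ℤ.- m) ≡ m ℤ.+ (z ℤ.- v)
    regroup = solve-∀

  ≈ᴸ-trans : ∀ {f g h} → f ≈ᴸ g → g ≈ᴸ h → f ≈ᴸ h
  ≈ᴸ-trans p q z = trans (p z) (q z)

  -- The ring axioms for Laurent series

  private
    -- The product is computed from the chosen representations, while `≈ᴸ` only compares
    -- coefficients. Padding `f`, which starts later, with `m` zeros makes the two starts equal;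
    -- then `f ≈ᴸ f′` becomes an equality of streams, which `conv` respects.
    *ᴸ-congʳ-≤ : ∀ f f′ g → start f′ ℤ.≤ start f → f ≈ᴸ f′ → f *ᴸ g ≈ᴸ f′ *ᴸ g
    *ᴸ-congʳ-≤ f f′ g s′≤s f≈f′ z = begin
      coeffᴸ z (laurent (s ℤ.+ w) (conv (coeffs f) (coeffs g)))
        ≈⟨ laurent-shift m (s ℤ.+ w) (conv (coeffs f) (coeffs g)) z ⟨
      coeffᴸ z (laurent (s ℤ.+ w ℤ.- + m) (shift m (conv (coeffs f) (coeffs g))))
        ≈⟨ laurent-cong start≡ (λ k → trans (sym (conv-shift m (coeffs f) (coeffs g) k)) (conv-congʳ shifted (coeffs g) k)) z ⟩
      coeffᴸ z (laurent (s′ ℤ.+ w) (conv (coeffs f′) (coeffs g))) ∎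
      where
      s s′ w : ℤ
      s  = start f
      s′ = start f′
      w  = start g
      m : ℕ
      m = ℤ.∣ s ℤ.- s′ ∣
      s-m≡s′ : s ℤ.- + m ≡ s′
      s-m≡s′ = ≡.trans (≡.cong (λ w → s ℤ.- w) (ℤ.0≤i⇒+∣i∣≡i (ℤ.i≤j⇒0≤j-i s′≤s))) (i-[i-j]≡j s s′)
        where
        i-[i-j]≡j : ∀ i j → i ℤ.- (i ℤ.- j) ≡ j
        i-[i-j]≡j = solve-∀
      start≡ : s ℤ.+ w ℤ.- + m ≡ s′ ℤ.+ w
      start≡ = ≡.trans (swap s w (+ m)) (≡.cong (λ v → v ℤ.+ w) s-m≡s′)
        where
        swap : ∀ s w m → s ℤ.+ w ℤ.- m ≡ s ℤ.- m ℤ.+ w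
        swap = solve-∀
      shifted : ∀ k → shift m (coeffs f) k ≈ coeffs f′ k
      shifted k = begin
        shift m (coeffs f) k                          ≡⟨ coeff-start f″ k ⟨
        coeffᴸ (start f″ ℤ.+ + k) f″                  ≈⟨ laurent-shift m s (coeffs f) (start f″ ℤ.+ + k) ⟩
        coeffᴸ (start f″ ℤ.+ + k) f                   ≈⟨ f≈f′ (start f″ ℤ.+ + k) ⟩
        coeffᴸ (start f″ ℤ.+ + k) f′                  ≡⟨ ≡.cong (λ v → coeffᴸ (v ℤ.+ + k) f′) s-m≡s′ ⟩
        coeffᴸ (s′ ℤ.+ + k) f′                        ≡⟨ coeff-start f′ k ⟩
        coeffs f′ k                                   ∎
        where
        f″ : Carrierᴸ
        f″ = laurent (s ℤ.- + m) (shift m (coeffs f))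

  *ᴸ-congʳ : ∀ f f′ g → f ≈ᴸ f′ → f *ᴸ g ≈ᴸ f′ *ᴸ g
  *ᴸ-congʳ f f′ g f≈f′ with ℤ.≤-total (start f′) (start f)
  ... | inj₁ s′≤s = *ᴸ-congʳ-≤ f f′ g s′≤s f≈f′
  ... | inj₂ s≤s′ = λ z → sym (*ᴸ-congʳ-≤ f′ f g s≤s′ (λ w → sym (f≈f′ w)) z)

  *ᴸ-comm : ∀ f g → f *ᴸ g ≈ᴸ g *ᴸ f
  *ᴸ-comm f g = laurent-cong (ℤ.+-comm (start f) (start g)) (conv-comm (coeffs f) (coeffs g))

  *ᴸ-assoc : ∀ f g h → (f *ᴸ g) *ᴸ h ≈ᴸ f *ᴸ (g *ᴸ h)
  *ᴸ-assoc f g h = laurent-cong (ℤ.+-assoc (start f) (start g) (start h))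
    (conv-assoc (coeffs f) (coeffs g) (coeffs h))

  -- Rewrites a series from any earlier start. Distributivity uses it to put both summands on the
  -- start of their sum, so that it reduces to distributivity of `conv`.
  laurent-from : ∀ v f → v ℤ.≤ start f → laurent v (λ k → coeffᴸ (v ℤ.+ + k) f) ≈ᴸ f
  laurent-from v f v≤s z with z ℤ.- v in eq
  ... | + k      = reflexive (≡.cong (λ w → coeffᴸ w f)
                     (≡.trans (≡.cong (λ w → v ℤ.+ w) (≡.sym eq)) (i+[j-i]≡j v z)))
  ... | -[1+ k ] = reflexive (≡.sym (coeff-below z f (ℤ.<-≤-trans (i-j≡-[1+k]⇒i<j z v eq) v≤s)))

  *ᴸ-distribʳ : ∀ h f g → (f +ᴸ g) *ᴸ h ≈ᴸ f *ᴸ h +ᴸ g *ᴸ h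
  *ᴸ-distribʳ h f g z = begin
    coeffᴸ z ((f +ᴸ g) *ᴸ h)
      ≈⟨ laurent-cong ≡.refl (conv-distribʳ (coeffs f′) (coeffs g′) (coeffs h)) z ⟩
    coeffᴸ z (laurent (v ℤ.+ start h) (λ k → coeffs (f′ *ᴸ h) k + coeffs (g′ *ᴸ h) k))
      ≈⟨ nth-+ _ _ (z ℤ.- (v ℤ.+ start h)) ⟩
    coeffᴸ z (f′ *ᴸ h) + coeffᴸ z (g′ *ᴸ h)
      ≈⟨ +-cong (*ᴸ-congʳ f′ f h (laurent-from v f (ℤ.i⊓j≤i (start f) (start g))) z)
                (*ᴸ-congʳ g′ g h (laurent-from v g (ℤ.i⊓j≤j (start f) (start g))) z) ⟩
    coeffᴸ z (f *ᴸ h) + coeffᴸ z (g *ᴸ h)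
      ≈⟨ coeff-+ z (f *ᴸ h) (g *ᴸ h) ⟨
    coeffᴸ z (f *ᴸ h +ᴸ g *ᴸ h) ∎
    where
    v : ℤ
    v = start f ℤ.⊓ start g
    f′ g′ : Carrierᴸ
    f′ = laurent v (λ k → coeffᴸ (v ℤ.+ + k) f)
    g′ = laurent v (λ k → coeffᴸ (v ℤ.+ + k) g)

  monomial-*-coeff : ∀ s w f z → coeffᴸ z (monomial rawRing s w *ᴸ f) ≈ s * coeffᴸ (z ℤ.- w) f
  monomial-*-coeff s w f z = begin
    nth rawRing (conv (δ rawRing s) (coeffs f)) (z ℤ.- (w ℤ.+ start f))
      ≈⟨ nth-cong (conv-δ s (coeffs f)) (z ℤ.- (w ℤ.+ start f)) ⟩
    nth rawRing (λ k → s * coeffs f k) (z ℤ.- (w ℤ.+ start f))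
      ≡⟨ ≡.cong (nth rawRing (λ k → s * coeffs f k)) (regroup z w (start f)) ⟩
    nth rawRing (λ k → s * coeffs f k) (z ℤ.- w ℤ.- start f)
      ≈⟨ nth-* (z ℤ.- w ℤ.- start f) ⟩
    s * nth rawRing (coeffs f) (z ℤ.- w ℤ.- start f) ∎
    where
    regroup : ∀ z w v → z ℤ.- (w ℤ.+ v) ≡ z ℤ.- w ℤ.- v
    regroup = solve-∀
    nth-* : ∀ w → nth rawRing (λ k → s * coeffs f k) w ≈ s * nth rawRing (coeffs f) w
    nth-* (+ k)    = refl
    nth-* -[1+ _ ] = sym (zeroʳ s)

  *ᴸ-identityˡ : ∀ f → L.1# *ᴸ f ≈ᴸ f
  *ᴸ-identityˡ f z = begin
    coeffᴸ z (L.1# *ᴸ f)      ≈⟨ monomial-*-coeff 1# 0ℤ f z ⟩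
    1# * coeffᴸ (z ℤ.- 0ℤ) f  ≈⟨ *-identityˡ _ ⟩
    coeffᴸ (z ℤ.- 0ℤ) f       ≡⟨ ≡.cong (λ w → coeffᴸ w f) (ℤ.+-identityʳ z) ⟩
    coeffᴸ z f                ∎

  *ᴸ-cong : ∀ {f f′ g g′} → f ≈ᴸ f′ → g ≈ᴸ g′ → f *ᴸ g ≈ᴸ f′ *ᴸ g′
  *ᴸ-cong {f} {f′} {g} {g′} p q z = begin
    coeffᴸ z (f *ᴸ g)   ≈⟨ *ᴸ-congʳ f f′ g p z ⟩
    coeffᴸ z (f′ *ᴸ g)  ≈⟨ *ᴸ-comm f′ g z ⟩
    coeffᴸ z (g *ᴸ f′)  ≈⟨ *ᴸ-congʳ g g′ f′ q z ⟩
    coeffᴸ z (g′ *ᴸ f′) ≈⟨ *ᴸ-comm g′ f′ z ⟩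
    coeffᴸ z (f′ *ᴸ g′) ∎

  laurent-isCommutativeRing : IsCommutativeRing _≈ᴸ_ _+ᴸ_ _*ᴸ_ L.-_ L.0# L.1#
  laurent-isCommutativeRing = record
    { isRing = record
      { +-isAbelianGroup = record
        { isGroup = record
          { isMonoid = record
            { isSemigroup = record
              { isMagma = record
                { isEquivalence = record
                  { refl  = λ _ → refl
                  ; sym   = λ p z → sym (p z)
                  ; trans = λ {f} {g} {h} → ≈ᴸ-trans {f} {g} {h}
                  }
                ; ∙-cong = λ {f} {f′} {g} {g′} p q z →
                    trans (coeff-+ z f g) (trans (+-cong (p z) (q z)) (sym (coeff-+ z f′ g′)))
                }
              ; assoc = λ f g h z → begin
                  coeffᴸ z (f +ᴸ g +ᴸ h)                    ≈⟨ trans (coeff-+ z (f +ᴸ g) h) (+-congʳ (coeff-+ z f g)) ⟩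
                  coeffᴸ z f + coeffᴸ z g + coeffᴸ z h      ≈⟨ +-assoc _ _ _ ⟩
                  coeffᴸ z f + (coeffᴸ z g + coeffᴸ z h)    ≈⟨ trans (coeff-+ z f (g +ᴸ h)) (+-congˡ (coeff-+ z g h)) ⟨
                  coeffᴸ z (f +ᴸ (g +ᴸ h))                  ∎
              }
            ; identity = +ᴸ-identityˡ ,
                λ f z → trans (+ᴸ-comm f L.0# z) (+ᴸ-identityˡ f z)
            }
          ; inverse = +ᴸ-inverseˡ ,
              λ f z → trans (+ᴸ-comm f (L.- f) z) (+ᴸ-inverseˡ f z)
          ; ⁻¹-cong = λ {f} {g} p z →
              trans (coeff-neg z f) (trans (-‿cong (p z)) (sym (coeff-neg z g)))
          }
        ; comm = +ᴸ-comm
        }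
      ; *-cong = λ {f} {f′} {g} {g′} → *ᴸ-cong {f} {f′} {g} {g′}
      ; *-assoc = *ᴸ-assoc
      ; *-identity = *ᴸ-identityˡ ,
          λ f z → trans (*ᴸ-comm f L.1# z) (*ᴸ-identityˡ f z)
      ; distrib = (λ h f g z → begin
          coeffᴸ z (h *ᴸ (f +ᴸ g))              ≈⟨ *ᴸ-comm h (f +ᴸ g) z ⟩
          coeffᴸ z ((f +ᴸ g) *ᴸ h)              ≈⟨ *ᴸ-distribʳ h f g z ⟩
          coeffᴸ z (f *ᴸ h +ᴸ g *ᴸ h)           ≈⟨ coeff-+ z (f *ᴸ h) (g *ᴸ h) ⟩
          coeffᴸ z (f *ᴸ h) + coeffᴸ z (g *ᴸ h) ≈⟨ +-cong (*ᴸ-comm f h z) (*ᴸ-comm g h z) ⟩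
          coeffᴸ z (h *ᴸ f) + coeffᴸ z (h *ᴸ g) ≈⟨ coeff-+ z (h *ᴸ f) (h *ᴸ g) ⟨
          coeffᴸ z (h *ᴸ f +ᴸ h *ᴸ g)           ∎) , *ᴸ-distribʳ
      }
    ; *-comm = *ᴸ-comm
    }
    where
    +ᴸ-comm : ∀ f g → f +ᴸ g ≈ᴸ g +ᴸ f
    +ᴸ-comm f g z = trans (coeff-+ z f g) (trans (+-comm _ _) (sym (coeff-+ z g f)))
    +ᴸ-identityˡ : ∀ f → L.0# +ᴸ f ≈ᴸ f
    +ᴸ-identityˡ f z = trans (coeff-+ z L.0# f) (trans (+-congʳ (coeff-0 z)) (+-identityˡ _))
    +ᴸ-inverseˡ : ∀ f → (L.- f) +ᴸ f ≈ᴸ L.0#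
    +ᴸ-inverseˡ f z = trans (coeff-+ z (L.- f) f)
      (trans (+-congʳ (coeff-neg z f)) (trans (-‿inverseˡ _) (sym (coeff-0 z))))

  laurentCommutativeRing : CommutativeRing 0ℓ 0ℓ
  laurentCommutativeRing = record { isCommutativeRing = laurent-isCommutativeRing }

  -- Monomials

  monomial-cong : ∀ {s t} v w → s ≈ t → v ≡ w → monomial rawRing s v ≈ᴸ monomial rawRing t w
  monomial-cong v w p v≡w = laurent-cong v≡w λ { zero → p ; (suc _) → refl }

  monomial-+ : ∀ s t w → monomial rawRing (s + t) w ≈ᴸ monomial rawRing s w +ᴸ monomial rawRing t w
  monomial-+ s t w z = begin
    coeffᴸ z (monomial rawRing (s + t) w)
      ≈⟨ nth-cong {b = λ k → δ rawRing s k + δ rawRing t k} (λ { zero → refl ; (suc _) → 0+0≈0 }) (z ℤ.- w) ⟩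
    nth rawRing (λ k → δ rawRing s k + δ rawRing t k) (z ℤ.- w)
      ≈⟨ nth-+ _ _ (z ℤ.- w) ⟩
    coeffᴸ z (monomial rawRing s w) + coeffᴸ z (monomial rawRing t w)
      ≈⟨ coeff-+ z (monomial rawRing s w) (monomial rawRing t w) ⟨
    coeffᴸ z (monomial rawRing s w +ᴸ monomial rawRing t w) ∎

  monomial-neg : ∀ s w → monomial rawRing (- s) w ≈ᴸ L.- monomial rawRing s w
  monomial-neg s w = laurent-cong {v = w} ≡.refl λ { zero → refl ; (suc _) → sym -0#≈0# }

  monomial-* : ∀ s t v w →
    monomial rawRing (s * t) (v ℤ.+ w) ≈ᴸ monomial rawRing s v *ᴸ monomial rawRing t w
  monomial-* s t v w = laurent-cong {v = v ℤ.+ w} ≡.refl λ k → trans (δ-* k) (sym (conv-δ s (δ rawRing t) k))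
    where
    δ-* : ∀ k → δ rawRing (s * t) k ≈ s * δ rawRing t k
    δ-* zero    = refl
    δ-* (suc _) = sym (zeroʳ s)

  monomial-0 : ∀ s w → s ≈ 0# → monomial rawRing s w ≈ᴸ L.0#
  monomial-0 s w s≈0 z = trans (zeros (z ℤ.- w)) (sym (coeff-0 z))
    where
    zeros : ∀ d → nth rawRing (δ rawRing s) d ≈ 0#
    zeros (+ zero)    = s≈0
    zeros (+ (suc _)) = refl
    zeros -[1+ _ ]    = refl

  -- Derivations of Laurent series: on the coefficients, and in the variable itself

  module _ (D : Derivation A) where
    open Derivation D

    private
      conv-∂ : ∀ a b k → ∂ (conv a b k) ≈ conv (λ j → ∂ (a j)) b k + conv a (λ j → ∂ (b j)) k
      conv-∂ a b zero    = trans (∂-+ _ _) (trans (+-cong (leibniz _ _) (trans ∂-0 0+0≈0)) (interchange _ _ _ _))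
      conv-∂ a b (suc k) = trans (∂-+ _ _) (trans (+-cong (leibniz _ _) (conv-∂ (tailˢ a) b k)) (interchange _ _ _ _))

      map-∂ : Carrierᴸ → Carrierᴸ
      map-∂ f = laurent (start f) (λ k → ∂ (coeffs f k))

    coeff-map-∂ : ∀ z f → coeffᴸ z (map-∂ f) ≈ ∂ (coeffᴸ z f)
    coeff-map-∂ z f with z ℤ.- start f
    ... | + k      = refl
    ... | -[1+ _ ] = sym ∂-0

    coefficientwise : Derivation laurentCommutativeRing
    coefficientwise = record
      { ∂       = map-∂
      ; ∂-cong  = λ {f} {g} p z → trans (coeff-map-∂ z f) (trans (∂-cong (p z)) (sym (coeff-map-∂ z g)))
      ; ∂-+     = λ f g z → begin
          coeffᴸ z (map-∂ (f +ᴸ g))                     ≈⟨ coeff-map-∂ z (f +ᴸ g) ⟩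
          ∂ (coeffᴸ z (f +ᴸ g))                         ≈⟨ trans (∂-cong (coeff-+ z f g)) (∂-+ _ _) ⟩
          ∂ (coeffᴸ z f) + ∂ (coeffᴸ z g)               ≈⟨ +-cong (coeff-map-∂ z f) (coeff-map-∂ z g) ⟨
          coeffᴸ z (map-∂ f) + coeffᴸ z (map-∂ g)       ≈⟨ coeff-+ z (map-∂ f) (map-∂ g) ⟨
          coeffᴸ z (map-∂ f +ᴸ map-∂ g)                 ∎
      ; leibniz = λ f g z → begin
          coeffᴸ z (map-∂ (f *ᴸ g))
            ≈⟨ nth-cong (conv-∂ (coeffs f) (coeffs g)) (z ℤ.- (start f ℤ.+ start g)) ⟩
          nth rawRing (λ k → coeffs (map-∂ f *ᴸ g) k + coeffs (f *ᴸ map-∂ g) k) (z ℤ.- (start f ℤ.+ start g))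
            ≈⟨ nth-+ _ _ (z ℤ.- (start f ℤ.+ start g)) ⟩
          coeffᴸ z (map-∂ f *ᴸ g) + coeffᴸ z (f *ᴸ map-∂ g)
            ≈⟨ coeff-+ z (map-∂ f *ᴸ g) (f *ᴸ map-∂ g) ⟨
          coeffᴸ z (map-∂ f *ᴸ g +ᴸ f *ᴸ map-∂ g) ∎
      }

    coefficientwise-monomial : ∀ s w → map-∂ (monomial rawRing s w) ≈ᴸ monomial rawRing (∂ s) w
    coefficientwise-monomial s w = laurent-cong {v = w} ≡.refl λ { zero → refl ; (suc _) → ∂-0 }

  module _ (φ : ℤ → Carrier) (φ-+ : ∀ i j → φ (i ℤ.+ j) ≈ φ i + φ j) where

    private
      weigh : ℤ → Stream → Stream
      weigh v a k = φ (v ℤ.+ + k) * a k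

      scale-∂ : ∀ v w a b → φ (v ℤ.+ w) * (a * b) ≈ φ v * a * b + a * (φ w * b)
      scale-∂ v w a b = begin
        φ (v ℤ.+ w) * (a * b)           ≈⟨ trans (*-congʳ (φ-+ v w)) (distribʳ _ _ _) ⟩
        φ v * (a * b) + φ w * (a * b)   ≈⟨ +-cong (sym (*-assoc _ _ _)) (trans (*-congˡ (*-comm _ _)) (trans (sym (*-assoc _ _ _)) (*-comm _ _))) ⟩
        φ v * a * b + a * (φ w * b)     ∎

      -- Removing the first coefficient of `a` leaves a stream that starts at `1 + v`, so the
      -- induction has to range over all starts.
      conv-weigh : ∀ v w a b k →
        weigh (v ℤ.+ w) (conv a b) k ≈ conv (weigh v a) b k + conv a (weigh w b) k
      conv-weigh v w a b zero = begin
        φ (v ℤ.+ w ℤ.+ 0ℤ) * (a 0 * b 0 + 0#)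
          ≈⟨ *-cong (reflexive (≡.cong φ (regroup v w))) (+-identityʳ _) ⟩
        φ (v ℤ.+ 0ℤ ℤ.+ (w ℤ.+ 0ℤ)) * (a 0 * b 0)
          ≈⟨ scale-∂ (v ℤ.+ 0ℤ) (w ℤ.+ 0ℤ) (a 0) (b 0) ⟩
        weigh v a 0 * b 0 + a 0 * weigh w b 0
          ≈⟨ +-cong (+-identityʳ _) (+-identityʳ _) ⟨
        weigh v a 0 * b 0 + 0# + (a 0 * weigh w b 0 + 0#) ∎
        where
        regroup : ∀ v w → v ℤ.+ w ℤ.+ 0ℤ ≡ v ℤ.+ 0ℤ ℤ.+ (w ℤ.+ 0ℤ)
        regroup = solve-∀
      conv-weigh v w a b (suc k) = begin
        φ (v ℤ.+ w ℤ.+ + suc k) * (a 0 * b (suc k) + conv (tailˢ a) b k)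
          ≈⟨ distribˡ _ _ _ ⟩
        φ (v ℤ.+ w ℤ.+ + suc k) * (a 0 * b (suc k)) + φ (v ℤ.+ w ℤ.+ + suc k) * conv (tailˢ a) b k
          ≈⟨ +-cong
               (trans (*-congʳ (reflexive (≡.cong φ (regroup₁ v w (+ k))))) (scale-∂ (v ℤ.+ 0ℤ) (w ℤ.+ + suc k) (a 0) (b (suc k))))
               (trans (*-congʳ (reflexive (≡.cong φ (regroup₂ v w (+ k))))) (conv-weigh (1ℤ ℤ.+ v) w (tailˢ a) b k)) ⟩
        weigh v a 0 * b (suc k) + a 0 * weigh w b (suc k) + (conv (weigh (1ℤ ℤ.+ v) (tailˢ a)) b k + conv (tailˢ a) (weigh w b) k)
          ≈⟨ +-congˡ (+-congʳ (conv-congʳ {a′ = tailˢ (weigh v a)} (λ j → *-congʳ {tailˢ a j} (reflexive (≡.cong φ (regroup₃ v (+ j))))) b k)) ⟩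
        weigh v a 0 * b (suc k) + a 0 * weigh w b (suc k) + (conv (tailˢ (weigh v a)) b k + conv (tailˢ a) (weigh w b) k)
          ≈⟨ interchange _ _ _ _ ⟩
        conv (weigh v a) b (suc k) + conv a (weigh w b) (suc k) ∎
        where
        regroup₁ : ∀ v w k → v ℤ.+ w ℤ.+ (1ℤ ℤ.+ k) ≡ v ℤ.+ 0ℤ ℤ.+ (w ℤ.+ (1ℤ ℤ.+ k))
        regroup₁ = solve-∀
        regroup₂ : ∀ v w k → v ℤ.+ w ℤ.+ (1ℤ ℤ.+ k) ≡ 1ℤ ℤ.+ v ℤ.+ w ℤ.+ k
        regroup₂ = solve-∀
        regroup₃ : ∀ v k → 1ℤ ℤ.+ v ℤ.+ k ≡ v ℤ.+ (1ℤ ℤ.+ k)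
        regroup₃ = solve-∀

      θ : Carrierᴸ → Carrierᴸ
      θ f = laurent (start f) (weigh (start f) (coeffs f))

    coeff-euler : ∀ z f → coeffᴸ z (θ f) ≈ φ z * coeffᴸ z f
    coeff-euler z f with z ℤ.- start f in eq
    ... | + k      = *-congʳ (reflexive (≡.cong φ
                       (≡.trans (≡.cong (λ w → start f ℤ.+ w) (≡.sym eq)) (i+[j-i]≡j (start f) z))))
    ... | -[1+ _ ] = sym (zeroʳ _)

    -- Multiplies the coefficient of X^z by `φ z`; additivity of `φ` is the Leibniz rule for X^v X^w
    -- = X^(v+w). For the embedding of ℤ as `φ` this is X d/dX.
    euler : Derivation laurentCommutativeRing
    euler = record
      { ∂       = θ
      ; ∂-cong  = λ {f} {g} p z → trans (coeff-euler z f) (trans (*-congˡ (p z)) (sym (coeff-euler z g)))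
      ; ∂-+     = λ f g z → begin
          coeffᴸ z (θ (f +ᴸ g))                   ≈⟨ coeff-euler z (f +ᴸ g) ⟩
          φ z * coeffᴸ z (f +ᴸ g)                 ≈⟨ trans (*-congˡ (coeff-+ z f g)) (distribˡ _ _ _) ⟩
          φ z * coeffᴸ z f + φ z * coeffᴸ z g     ≈⟨ +-cong (coeff-euler z f) (coeff-euler z g) ⟨
          coeffᴸ z (θ f) + coeffᴸ z (θ g)         ≈⟨ coeff-+ z (θ f) (θ g) ⟨
          coeffᴸ z (θ f +ᴸ θ g)                   ∎
      ; leibniz = λ f g z → begin
          coeffᴸ z (θ (f *ᴸ g))
            ≈⟨ nth-cong (conv-weigh (start f) (start g) (coeffs f) (coeffs g)) (z ℤ.- (start f ℤ.+ start g)) ⟩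
          nth rawRing (λ k → coeffs (θ f *ᴸ g) k + coeffs (f *ᴸ θ g) k) (z ℤ.- (start f ℤ.+ start g))
            ≈⟨ nth-+ _ _ (z ℤ.- (start f ℤ.+ start g)) ⟩
          coeffᴸ z (θ f *ᴸ g) + coeffᴸ z (f *ᴸ θ g)
            ≈⟨ coeff-+ z (θ f *ᴸ g) (f *ᴸ θ g) ⟨
          coeffᴸ z (θ f *ᴸ g +ᴸ f *ᴸ θ g) ∎
      }

    euler-monomial : ∀ s w → θ (monomial rawRing s w) ≈ᴸ monomial rawRing (φ w * s) w
    euler-monomial s w = laurent-cong {v = w} ≡.refl
      λ { zero → *-congʳ (reflexive (≡.cong φ (ℤ.+-identityʳ w))) ; (suc _) → zeroʳ _ }

  -- Inverses of differences

  monomial-- : ∀ s t w →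
    monomial rawRing s w +ᴸ (L.- monomial rawRing t w) ≈ᴸ monomial rawRing (s - t) w
  monomial-- s t w z = begin
    coeffᴸ z (S +ᴸ (L.- T))           ≈⟨ coeff-+ z S (L.- T) ⟩
    coeffᴸ z S + coeffᴸ z (L.- T)     ≈⟨ +-congˡ (monomial-neg t w z) ⟨
    coeffᴸ z S + coeffᴸ z T′          ≈⟨ coeff-+ z S T′ ⟨
    coeffᴸ z (S +ᴸ T′)                ≈⟨ monomial-+ s (- t) w z ⟨
    coeffᴸ z (monomial rawRing (s - t) w) ∎
    where
    S T T′ : Carrierᴸ
    S  = monomial rawRing s w
    T  = monomial rawRing t w
    T′ = monomial rawRing (- t) w

  constant-inverse : ∀ s t u → (s - t) * u ≈ 1# →
    (monomial rawRing s 0ℤ +ᴸ (L.- monomial rawRing t 0ℤ)) *ᴸ monomial rawRing u 0ℤ ≈ᴸ L.1#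
  constant-inverse s t u p z = trans
    (*ᴸ-congʳ (monomial rawRing s 0ℤ +ᴸ (L.- monomial rawRing t 0ℤ)) (monomial rawRing (s - t) 0ℤ)
      (monomial rawRing u 0ℤ) (monomial-- s t 0ℤ) z)
    (trans (sym (monomial-* (s - t) u 0ℤ 0ℤ z)) (monomial-cong 0ℤ 0ℤ p ≡.refl z))

  -- The hypotheses make `a k` the power s^(-1-k), and the product telescopes. Taking `s` = 1 gives
  -- the expansion of 1/(1 - xₙ), and `s` = xᵢ that of 1/(xᵢ - xₙ), where xₙ is the outermost
  -- variable.
  geometric-inverse : ∀ s a → s * a 0 ≈ 1# → (∀ k → s * a (suc k) ≈ a k) →
    (monomial rawRing s 0ℤ +ᴸ (L.- monomial rawRing 1# 1ℤ)) *ᴸ laurent 0ℤ a ≈ᴸ L.1#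
  geometric-inverse s a head≈ tail≈ z = begin
    coeffᴸ z ((S +ᴸ (L.- X)) *ᴸ U)
      ≈⟨ *ᴸ-distribʳ U S (L.- X) z ⟩
    coeffᴸ z (S *ᴸ U +ᴸ (L.- X) *ᴸ U)
      ≈⟨ coeff-+ z (S *ᴸ U) ((L.- X) *ᴸ U) ⟩
    coeffᴸ z (S *ᴸ U) + coeffᴸ z ((L.- X) *ᴸ U)
      ≈⟨ +-congˡ (trans (sym (-‿distribˡ-*ᴸ X U z)) (coeff-neg z (X *ᴸ U))) ⟩
    coeffᴸ z (S *ᴸ U) - coeffᴸ z (X *ᴸ U)
      ≈⟨ +-cong (monomial-*-coeff s 0ℤ U z)
                (-‿cong (trans (monomial-*-coeff 1# 1ℤ U z) (*-identityˡ _))) ⟩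
    s * nth rawRing a (z ℤ.- 0ℤ ℤ.- 0ℤ) - nth rawRing a (z ℤ.- 1ℤ ℤ.- 0ℤ)
      ≡⟨ ≡.cong₂ (λ v w → s * nth rawRing a v - nth rawRing a w)
           (≡.trans (ℤ.+-identityʳ (z ℤ.- 0ℤ)) (ℤ.+-identityʳ z)) (ℤ.+-identityʳ (z ℤ.- 1ℤ)) ⟩
    s * nth rawRing a z - nth rawRing a (z ℤ.- 1ℤ)
      ≈⟨ telescope z ⟩
    nth rawRing (δ rawRing 1#) z
      ≡⟨ ≡.cong (nth rawRing (δ rawRing 1#)) (ℤ.+-identityʳ z) ⟨
    coeffᴸ z L.1# ∎
    where
    open RingProperties (CommutativeRing.ring laurentCommutativeRing)
      renaming (-‿distribˡ-* to -‿distribˡ-*ᴸ) using ()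
    S X U : Carrierᴸ
    S = monomial rawRing s 0ℤ
    X = monomial rawRing 1# 1ℤ
    U = laurent 0ℤ a
    telescope : ∀ z → s * nth rawRing a z - nth rawRing a (z ℤ.- 1ℤ) ≈ nth rawRing (δ rawRing 1#) z
    telescope (+ zero)  = trans (+-cong head≈ -0#≈0#) (+-identityʳ 1#)
    telescope (+ suc k) = trans (+-congʳ (tail≈ k)) (-‿inverseʳ (a k))
    telescope -[1+ k ]  = trans (+-cong (zeroʳ s) -0#≈0#) (+-identityʳ 0#)

-- The iterated series and the residue

ι-+ : ∀ i j → ι (i ℤ.+ j) ≡ ι i ℚ.+ ι j
ι-+ i j = ℚ.toℚᵘ-injective (begin
  ℚ.toℚᵘ (ι (i ℤ.+ j))                   ≈⟨ ℚ.toℚᵘ-fromℚᵘ (ℚᵘ.mkℚᵘ (i ℤ.+ j) 0) ⟩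
  ℚᵘ.mkℚᵘ (i ℤ.+ j) 0                    ≈⟨ ℚᵘ.*≡* (cross i j) ⟩
  ℚᵘ.mkℚᵘ i 0 ℚᵘ.+ ℚᵘ.mkℚᵘ j 0           ≈⟨ ℚᵘ.+-cong (ℚ.toℚᵘ-fromℚᵘ (ℚᵘ.mkℚᵘ i 0)) (ℚ.toℚᵘ-fromℚᵘ (ℚᵘ.mkℚᵘ j 0)) ⟨
  ℚ.toℚᵘ (ι i) ℚᵘ.+ ℚ.toℚᵘ (ι j)         ≈⟨ ℚ.toℚᵘ-homo-+ (ι i) (ι j) ⟨
  ℚ.toℚᵘ (ι i ℚ.+ ι j)                   ∎)
  where
  open SetoidReasoning ℚᵘ.≃-setoid
  cross : ∀ i j → (i ℤ.+ j) ℤ.* 1ℤ ≡ (i ℤ.* 1ℤ ℤ.+ j ℤ.* 1ℤ) ℤ.* 1ℤ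
  cross = solve-∀

ι-neg : ∀ i → ι (ℤ.- i) ≡ ℚ.- ι i
ι-neg i = +-inverseʳ-unique (ι i) (ι (ℤ.- i))
  (≡.trans (≡.sym (ι-+ i (ℤ.- i))) (≡.cong ι (ℤ.+-inverseʳ i)))
  where open RingProperties ℚ.+-*-ring using (+-inverseʳ-unique)

k/2≡½*k : ∀ k → k ℚ./ 2 ≡ ½ ℚ.* ι k
k/2≡½*k k = ℚ.toℚᵘ-injective (begin
  ℚ.toℚᵘ (k ℚ./ 2)                  ≈⟨ ℚ.toℚᵘ-fromℚᵘ (ℚᵘ.mkℚᵘ k 1) ⟩
  ℚᵘ.mkℚᵘ k 1                       ≈⟨ ℚᵘ.*≡* (cross k) ⟩
  ℚ.toℚᵘ ½ ℚᵘ.* ℚᵘ.mkℚᵘ k 0         ≈⟨ ℚᵘ.*-congˡ {ℚ.toℚᵘ ½} (ℚ.toℚᵘ-fromℚᵘ (ℚᵘ.mkℚᵘ k 0)) ⟨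
  ℚ.toℚᵘ ½ ℚᵘ.* ℚ.toℚᵘ (ι k)        ≈⟨ ℚ.toℚᵘ-homo-* ½ (ι k) ⟨
  ℚ.toℚᵘ (½ ℚ.* ι k)                ∎)
  where
  open SetoidReasoning ℚᵘ.≃-setoid
  cross : ∀ k → k ℤ.* + 2 ≡ (1ℤ ℤ.* k) ℤ.* + 2
  cross = solve-∀

-- The rings of iterated series as algebras over ℚ

iteratedRing : ℕ → CommutativeRing 0ℓ 0ℓ

iterated-isCommutativeRing : ∀ n → let open RawRing (iterated n) in
  IsCommutativeRing _≈_ _+_ _*_ -_ 0# 1#

iteratedRing n = record { isCommutativeRing = iterated-isCommutativeRing n }

iterated-isCommutativeRing zero    = ℚ.+-*-isCommutativeRing
iterated-isCommutativeRing (suc n) = LaurentSeries.laurent-isCommutativeRing (iteratedRing n)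

scalar : ∀ n → ℚ → Series n
scalar zero    q = q
scalar (suc n) q = const {n} (scalar n q)

const-isRingHomomorphism : ∀ n →
  IsRingHomomorphism (iterated n) (iterated (suc n)) (const {n})
const-isRingHomomorphism n = record
  { isSemiringHomomorphism = record
    { isNearSemiringHomomorphism = record
      { +-isMonoidHomomorphism = record
        { isMagmaHomomorphism = record
          { isRelHomomorphism = record { cong = λ p → monomial-cong 0ℤ 0ℤ p ≡.refl }
          ; homo = λ f g → monomial-+ f g 0ℤ
          }
        ; ε-homo = λ z → refl {coeffᴸ z (monomial rawRing 0# 0ℤ)}
        }
      ; *-homo = λ f g → monomial-* f g 0ℤ 0ℤ
      }
    ; 1#-homo = λ z → refl {coeffᴸ z (monomial rawRing 1# 0ℤ)}
    }
  ; -‿homo = λ f → monomial-neg f 0ℤ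
  }
  where
  open CommutativeRing (iteratedRing n)
  open LaurentSeries (iteratedRing n)

scalar-isRingHomomorphism : ∀ n →
  IsRingHomomorphism ℚ.+-*-rawRing (iterated n) (scalar n)
scalar-isRingHomomorphism zero = Identity.isRingHomomorphism ℚ.+-*-rawRing ≡.refl
scalar-isRingHomomorphism (suc n) = Composition.isRingHomomorphism
  (λ {f} {g} {h} → LaurentSeries.≈ᴸ-trans (iteratedRing n) {f} {g} {h})
  (scalar-isRingHomomorphism n) (const-isRingHomomorphism n)

module _ (n : ℕ) where
  open CommutativeRing (iteratedRing n)

  -- The operators xᵢ ∂/∂xᵢ on iterated series

  weight : ℤ → Series n
  weight z = scalar n (ι z)

  weight-+ : ∀ i j → weight (i ℤ.+ j) ≈ weight i + weight j
  weight-+ i j = trans (reflexive (≡.cong (scalar n) (ι-+ i j))) (+-homo (ι i) (ι j))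
    where open IsRingHomomorphism (scalar-isRingHomomorphism n)

-- The recursion follows the nesting: the outermost variable is handled by weighting exponents, any
-- other by acting on the coefficients. Unlike ∂/∂xᵢ, this operator keeps every exponent in place
-- and only scales coefficients.
θ : ∀ n → Fin n → Derivation (iteratedRing n)
θ (suc n) i with view i
... | ‵fromℕ     = LaurentSeries.euler (iteratedRing n) (weight n) (weight-+ n)
... | ‵inject₁ i = LaurentSeries.coefficientwise (iteratedRing n) (θ n i)

θ-x^ : ∀ n i z → let open CommutativeRing (iteratedRing n); open Derivation (θ n i) in
  ∂ (x^ i z) ≈ weight n z * x^ i z
θ-x^ (suc n) i z with view i
... | ‵fromℕ     = λ c → trans (euler-monomial (weight n) (weight-+ n) 1# z c) (trans
                     (monomial-cong z (0ℤ ℤ.+ z) refl (≡.sym (ℤ.+-identityˡ z)) c) (monomial-* (weight n z) 1# 0ℤ z c))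
  where
  open CommutativeRing (iteratedRing n)
  open LaurentSeries (iteratedRing n)
... | ‵inject₁ i = λ c → trans (coefficientwise-monomial (θ n i) (x^ i z) 0ℤ c) (trans
                     (monomial-cong 0ℤ 0ℤ (θ-x^ n i z) ≡.refl c) (monomial-* (weight n z) (x^ i z) 0ℤ 0ℤ c))
  where
  open CommutativeRing (iteratedRing n)
  open LaurentSeries (iteratedRing n)

θ-x^-≢ : ∀ n {i j} z → i ≢ j → let open CommutativeRing (iteratedRing n); open Derivation (θ n i) in
  ∂ (x^ j z) ≈ 0#
θ-x^-≢ (suc n) {i} {j} z i≢j with view i | view j
... | ‵fromℕ     | ‵fromℕ     = ⊥-elim (i≢j ≡.refl)
... | ‵fromℕ     | ‵inject₁ j = λ c → trans (euler-monomial (weight n) (weight-+ n) (x^ j z) 0ℤ c)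
                                  (monomial-0 _ 0ℤ (trans (*-congʳ 0#-homo) (zeroˡ _)) c)
  where
  open CommutativeRing (iteratedRing n)
  open LaurentSeries (iteratedRing n)
  open IsRingHomomorphism (scalar-isRingHomomorphism n) using (0#-homo)
... | ‵inject₁ i | ‵fromℕ     = λ c → trans (coefficientwise-monomial (θ n i) 1# z c)
                                  (monomial-0 _ z (Derivation.∂-1 (θ n i)) c)
  where
  open CommutativeRing (iteratedRing n)
  open LaurentSeries (iteratedRing n)
... | ‵inject₁ i | ‵inject₁ j = λ c → trans (coefficientwise-monomial (θ n i) (x^ j z) 0ℤ c)
                                  (monomial-0 _ 0ℤ (θ-x^-≢ n z (λ i≡j → i≢j (≡.cong inject₁ i≡j))) c)
  where
  open CommutativeRing (iteratedRing n)
  open LaurentSeries (iteratedRing n)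

-- Powers of the variables and the expanded inverses

x^-+ : ∀ n (i : Fin n) v w → let open CommutativeRing (iteratedRing n) in
  x^ i (v ℤ.+ w) ≈ x^ i v * x^ i w
x^-+ (suc n) i v w with view i
... | ‵fromℕ     = λ c → trans (monomial-cong (v ℤ.+ w) (v ℤ.+ w) (sym (*-identityˡ 1#)) ≡.refl c)
                     (monomial-* 1# 1# v w c)
  where
  open CommutativeRing (iteratedRing n)
  open LaurentSeries (iteratedRing n)
... | ‵inject₁ i = λ c → trans (monomial-cong 0ℤ 0ℤ (x^-+ n i v w) ≡.refl c)
                     (monomial-* (x^ i v) (x^ i w) 0ℤ 0ℤ c)
  where
  open CommutativeRing (iteratedRing n)
  open LaurentSeries (iteratedRing n)

x^-0 : ∀ n (i : Fin n) → let open CommutativeRing (iteratedRing n) in x^ i 0ℤ ≈ 1#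
x^-0 (suc n) i with view i
... | ‵fromℕ     = λ c → CommutativeRing.refl (iteratedRing n)
... | ‵inject₁ i = LaurentSeries.monomial-cong (iteratedRing n) 0ℤ 0ℤ (x^-0 n i) ≡.refl

1/⟨1-x⟩-inverse : ∀ n (i : Fin n) → let open CommutativeRing (iteratedRing n) in
  y i * 1/⟨1-x i ⟩ ≈ 1#
1/⟨1-x⟩-inverse (suc n) i with view i
... | ‵fromℕ     = LaurentSeries.geometric-inverse (iteratedRing n) 1# (λ _ → 1#)
                     (*-identityˡ 1#) (λ _ → *-identityˡ 1#)
  where open CommutativeRing (iteratedRing n)
... | ‵inject₁ i = LaurentSeries.constant-inverse (iteratedRing n) 1# (x i) 1/⟨1-x i ⟩ (1/⟨1-x⟩-inverse n i)
  where open CommutativeRing (iteratedRing n)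

1/⟨x-x⟩-inverse : ∀ n (i j : Fin n) .(i<j : i Fin.< j) → let open CommutativeRing (iteratedRing n) in
  (x i - x j) * 1/⟨x i -x j ⟩ i<j ≈ 1#
1/⟨x-x⟩-inverse (suc n) i j i<j with view i | view j
... | ‵fromℕ     | _          = contradiction-irr i<j (≤⇒≯ (≤fromℕ j))
... | ‵inject₁ i | ‵fromℕ     = LaurentSeries.geometric-inverse (iteratedRing n) (x i) (λ k → x^ i -[1+ k ])
                                  (trans (sym (x^-+ n i 1ℤ -1ℤ)) (x^-0 n i))
                                  (λ k → sym (x^-+ n i 1ℤ -[1+ suc k ]))
  where open CommutativeRing (iteratedRing n)
... | ‵inject₁ i | ‵inject₁ j = LaurentSeries.constant-inverse (iteratedRing n) (x i) (x j) (1/⟨x i -x j ⟩ _)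
                                  (1/⟨x-x⟩-inverse n i j (≡.subst₂ ℕ._<_ (toℕ-inject₁ i) (toℕ-inject₁ j) i<j))

-- The residue

Res-cong : ∀ n {f g} → RawRing._≈_ (iterated n) f g → Res {n} f ≡ Res {n} g
Res-cong zero    p = p
Res-cong (suc n) p = Res-cong n (p -1ℤ)

Res-+ : ∀ n f g → Res {n} (RawRing._+_ (iterated n) f g) ≡ Res {n} f ℚ.+ Res {n} g
Res-+ zero    f g = ≡.refl
Res-+ (suc n) f g = ≡.trans (Res-cong n (LaurentSeries.coeff-+ (iteratedRing n) -1ℤ f g)) (Res-+ n _ _)

Res-scalar : ∀ n q f → Res {n} (RawRing._*_ (iterated n) (scalar n q) f) ≡ q ℚ.* Res {n} f
Res-scalar zero    q f = ≡.refl
Res-scalar (suc n) q f = ≡.trans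
  (Res-cong n (LaurentSeries.monomial-*-coeff (iteratedRing n) (scalar n q) 0ℤ f -1ℤ)) (Res-scalar n q _)

-- At the level of xᵢ the residue reads the coefficient with exponent -1, which `θ` multiplies by
-- -1. At the levels outside xᵢ, `θ` commutes with taking the coefficient.
Res-θ : ∀ n i f → let open Derivation (θ n i) in Res {n} (∂ f) ≡ ℚ.- Res {n} f
Res-θ (suc n) i f with view i
... | ‵fromℕ     = ≡.trans
  (Res-cong n (LaurentSeries.coeff-euler (iteratedRing n) (weight n) (weight-+ n) -1ℤ f))
  (≡.trans (Res-scalar n (ι -1ℤ) _) (≡.sym (neg≡-1* (Res {suc n} f))))
  where
  neg≡-1* : ∀ p → ℚ.- p ≡ ι -1ℤ ℚ.* p
  neg≡-1* p = ≡.trans (≡.cong ℚ.-_ (≡.sym (ℚ.*-identityˡ p))) (ℚ.neg-distribˡ-* 1ℚ p)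
... | ‵inject₁ i = ≡.trans
  (Res-cong n (LaurentSeries.coeff-map-∂ (iteratedRing n) (θ n i) -1ℤ f)) (Res-θ n i _)

Res-0 : ∀ n → Res {n} (RawRing.0# (iterated n)) ≡ 0ℚ
Res-0 n = +-identityʳ-unique _ _ (≡.trans (≡.sym (Res-+ n 0# 0#)) (Res-cong n (+-identityˡ 0#)))
  where
  open CommutativeRing (iteratedRing n) using (0#; +-identityˡ)
  open RingProperties ℚ.+-*-ring using (+-identityʳ-unique)

Res-neg : ∀ n f → Res {n} (RawRing.-_ (iterated n) f) ≡ ℚ.- Res {n} f
Res-neg n f = +-inverseʳ-unique _ _
  (≡.trans (≡.sym (Res-+ n f _)) (≡.trans (Res-cong n (-‿inverseʳ f)) (Res-0 n)))
  where
  open CommutativeRing (iteratedRing n) using (-‿inverseʳ)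
  open RingProperties ℚ.+-*-ring using (+-inverseʳ-unique)

Res-sum≡0 : ∀ n {k} (f : Vector (Series n) k) → (∀ i → Res {n} (f i) ≡ 0ℚ) →
  Res {n} (SemiringSum.sum (CommutativeRing.semiring (iteratedRing n)) f) ≡ 0ℚ
Res-sum≡0 n {zero}  f p = Res-0 n
Res-sum≡0 n {suc k} f p = ≡.trans (Res-+ n _ _)
  (≡.cong₂ ℚ._+_ (p zero) (Res-sum≡0 n (tail f) (λ i → p (suc i))))

-- Elementary symmetric polynomials

module ℚ-Algebra
  (R : CommutativeRing 0ℓ 0ℓ) (φ : ℚ → CommutativeRing.Carrier R)
  (φ-isRingHomomorphism : IsRingHomomorphism ℚ.+-*-rawRing (CommutativeRing.rawRing R) φ) where
  open CommutativeRing R hiding (zero)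
  open RingProperties ring using (-0#≈0#)
  open SemiringSum semiring using (sum; sum-cong-≋; ∑-distrib-+; ∑-comm; *-distribˡ-sum)
  open SetoidReasoning setoid
  private module φ = IsRingHomomorphism φ-isRingHomomorphism

  -- The solver's interpretation of coefficients: φ, except that 1 is sent
  -- to 1# itself, so that con 1ℚ stands for 1#.
  literal : ℚ → Carrier
  literal q = if does (q ℚ.≟ 1ℚ) then 1# else φ q

  literal≈φ : ∀ q → literal q ≈ φ q
  literal≈φ q with q ℚ.≟ 1ℚ
  ... | yes q≡1 = sym (trans (φ.⟦⟧-cong q≡1) φ.1#-homo)
  ... | no  _   = refl

  literal-morphism : ℚ.+-*-rawRing -Raw-AlmostCommutative⟶ fromCommutativeRing R
  literal-morphism = record
    { ⟦_⟧    = literal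
    ; +-homo = λ p q → trans (literal≈φ (p ℚ.+ q)) (trans (φ.+-homo p q)
                 (sym (+-cong (literal≈φ p) (literal≈φ q))))
    ; *-homo = λ p q → trans (literal≈φ (p ℚ.* q)) (trans (φ.*-homo p q)
                 (sym (*-cong (literal≈φ p) (literal≈φ q))))
    ; -‿homo = λ p → trans (literal≈φ (ℚ.- p)) (trans (φ.-‿homo p) (sym (-‿cong (literal≈φ p))))
    ; 0-homo = φ.0#-homo
    ; 1-homo = refl
    }

  literal-≟ : ∀ p q → Maybe (literal p ≈ literal q)
  literal-≟ p q with p ℚ.≟ q
  ... | yes p≡q = just (reflexive (≡.cong literal p≡q))
  ... | no  _   = nothing

  open RingSolver ℚ.+-*-rawRing (fromCommutativeRing R) literal-morphism literal-≟
    using (solve; _:=_; _:+_; _:*_; _:-_; :-_; con) public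

  number : ℤ → Carrier
  number z = φ (ι z)

  number-+ : ∀ i j → number (i ℤ.+ j) ≈ number i + number j
  number-+ i j = trans (φ.⟦⟧-cong (ι-+ i j)) (φ.+-homo (ι i) (ι j))

  number-neg : ∀ i → number (ℤ.- i) ≈ - number i
  number-neg i = trans (φ.⟦⟧-cong (ι-neg i)) (φ.-‿homo (ι i))

  number-- : ∀ i j → number (i ℤ.- j) ≈ number i - number j
  number-- i j = trans (number-+ i (ℤ.- j)) (+-congˡ (number-neg j))

  number-suc : ∀ k → number (+ suc k) ≈ 1# + number (+ k)
  number-suc k = trans (number-+ 1ℤ (+ k)) (+-congʳ φ.1#-homo)

  -- Multiplication and division of power series by linear factors

  private
    Sequence : Set
    Sequence = ℕ → Carrier
    variable
      n : ℕ

  sum-+-* : ∀ c (f g : Vector Carrier n) → (sum λ i → f i + c * g i) ≈ sum f + c * sum g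
  sum-+-* c f g = trans (∑-distrib-+ f (λ i → c * g i)) (+-congˡ (sym (*-distribˡ-sum c g)))

  -- A sequence s stands for the power series Σ s k T^k; timesLinear a and
  -- overLinear a multiply and divide it by 1 + a T.
  timesLinear : Carrier → Sequence → Sequence
  timesLinear a s zero    = s 0
  timesLinear a s (suc k) = s (suc k) + a * s k

  overLinear : Carrier → Sequence → Sequence
  overLinear a s zero    = s 0
  overLinear a s (suc k) = s (suc k) - a * overLinear a s k

  overLinear-cong : ∀ a {s s′} → (∀ k → s k ≈ s′ k) → ∀ k → overLinear a s k ≈ overLinear a s′ k
  overLinear-cong a p zero    = p 0
  overLinear-cong a p (suc k) = +-cong (p (suc k)) (-‿cong (*-congˡ (overLinear-cong a p k)))

  timesLinear-cong : ∀ a {s s′} → (∀ k → s k ≈ s′ k) → ∀ k → timesLinear a s k ≈ timesLinear a s′ k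
  timesLinear-cong a p zero    = p 0
  timesLinear-cong a p (suc k) = +-cong (p (suc k)) (*-congˡ (p k))

  overLinear-timesLinear : ∀ a s k → overLinear a (timesLinear a s) k ≈ s k
  overLinear-timesLinear a s zero    = refl
  overLinear-timesLinear a s (suc k) = trans
    (+-congˡ (-‿cong (*-congˡ (overLinear-timesLinear a s k))))
    (solve 3 (λ a s₁ s₀ → s₁ :+ a :* s₀ :- a :* s₀ := s₁) refl a (s (suc k)) (s k))

  timesLinear-overLinear : ∀ a s k → timesLinear a (overLinear a s) k ≈ s k
  timesLinear-overLinear a s zero    = refl
  timesLinear-overLinear a s (suc k) =
    solve 2 (λ s p → s :- p :+ p := s) refl (s (suc k)) (a * overLinear a s k)

  timesLinear-comm : ∀ a b s k → timesLinear a (timesLinear b s) k ≈ timesLinear b (timesLinear a s) k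
  timesLinear-comm a b s zero          = refl
  timesLinear-comm a b s (suc zero)    =
    solve 4 (λ a b s₁ s₀ → s₁ :+ b :* s₀ :+ a :* s₀ := s₁ :+ a :* s₀ :+ b :* s₀) refl a b (s 1) (s 0)
  timesLinear-comm a b s (suc (suc k)) =
    solve 5 (λ a b s₂ s₁ s₀ → s₂ :+ b :* s₁ :+ a :* (s₁ :+ b :* s₀)
                           := s₂ :+ a :* s₁ :+ b :* (s₁ :+ a :* s₀))
      refl a b (s (suc (suc k))) (s (suc k)) (s k)

  overLinear-timesLinear-comm : ∀ a b s k →
    overLinear b (timesLinear a s) k ≈ timesLinear a (overLinear b s) k
  overLinear-timesLinear-comm a b s k = begin
    overLinear b (timesLinear a s) k
      ≈⟨ overLinear-cong b (timesLinear-cong a (timesLinear-overLinear b s)) k ⟨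
    overLinear b (timesLinear a (timesLinear b (overLinear b s))) k
      ≈⟨ overLinear-cong b (timesLinear-comm a b (overLinear b s)) k ⟩
    overLinear b (timesLinear b (timesLinear a (overLinear b s))) k
      ≈⟨ overLinear-timesLinear b (timesLinear a (overLinear b s)) k ⟩
    timesLinear a (overLinear b s) k ∎

  -- Partial fractions: (b - a) / ((1 + aT)(1 + bT)) = b / (1 + bT) - a / (1 + aT). For elementary
  -- symmetric polynomials it relates those without two variables to those without one of them.
  overLinear-partialFractions : ∀ a b s k →
    (b - a) * overLinear a (overLinear b s) k ≈ b * overLinear b s k - a * overLinear a s k
  overLinear-partialFractions a b s zero    =
    solve 3 (λ a b s → (b :- a) :* s := b :* s :- a :* s) refl a b (s 0)
  overLinear-partialFractions a b s (suc k) = begin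
    (b - a) * (s (suc k) - b * p - a * q)
      ≈⟨ solve 5 (λ a b s p q → (b :- a) :* (s :- b :* p :- a :* q)
                             := (b :- a) :* (s :- b :* p) :- a :* ((b :- a) :* q))
           refl a b (s (suc k)) p q ⟩
    (b - a) * (s (suc k) - b * p) - a * ((b - a) * q)
      ≈⟨ +-congˡ (-‿cong (*-congˡ (overLinear-partialFractions a b s k))) ⟩
    (b - a) * (s (suc k) - b * p) - a * (b * p - a * r)
      ≈⟨ solve 5 (λ a b s p r → (b :- a) :* (s :- b :* p) :- a :* (b :* p :- a :* r)
                             := b :* (s :- b :* p) :- a :* (s :- a :* r))
           refl a b (s (suc k)) p r ⟩
    b * (s (suc k) - b * p) - a * (s (suc k) - a * r) ∎
    where
    p q r : Carrier
    p = overLinear b s k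
    q = overLinear a (overLinear b s) k
    r = overLinear a s k

  overLinear-comm : ∀ a b s k → overLinear a (overLinear b s) k ≈ overLinear b (overLinear a s) k
  overLinear-comm a b s k = begin
    overLinear a (overLinear b s) k
      ≈⟨ overLinear-cong a (overLinear-cong b (timesLinear-overLinear a s)) k ⟨
    overLinear a (overLinear b (timesLinear a (overLinear a s))) k
      ≈⟨ overLinear-cong a (overLinear-timesLinear-comm a b (overLinear a s)) k ⟩
    overLinear a (timesLinear a (overLinear b (overLinear a s))) k
      ≈⟨ overLinear-timesLinear a (overLinear b (overLinear a s)) k ⟩
    overLinear b (overLinear a s) k ∎

  overLinear-* : ∀ a c s k → overLinear a (λ j → c * s j) k ≈ c * overLinear a s k
  overLinear-* a c s zero    = refl
  overLinear-* a c s (suc k) = trans (+-congˡ (-‿cong (*-congˡ (overLinear-* a c s k))))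
    (solve 4 (λ a c s r → c :* s :- a :* (c :* r) := c :* (s :- a :* r)) refl a c (s (suc k)) (overLinear a s k))

  overLinear-sum : ∀ a (s : Fin n → Sequence) k →
    overLinear a (λ j → sum λ i → s i j) k ≈ sum λ i → overLinear a (s i) k
  overLinear-sum a s zero    = refl
  overLinear-sum a s (suc k) = begin
    (sum λ i → s i (suc k)) - a * overLinear a (λ j → sum λ i → s i j) k
      ≈⟨ +-congˡ (-‿cong (*-congˡ (overLinear-sum a s k))) ⟩
    (sum λ i → s i (suc k)) - a * (sum λ i → overLinear a (s i) k)
      ≈⟨ solve 3 (λ s a t → s :- a :* t := s :+ (:- a) :* t) refl _ a _ ⟩
    (sum λ i → s i (suc k)) + - a * (sum λ i → overLinear a (s i) k)
      ≈⟨ sum-+-* (- a) (λ i → s i (suc k)) (λ i → overLinear a (s i) k) ⟨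
    (sum λ i → s i (suc k) + - a * overLinear a (s i) k)
      ≈⟨ sum-cong-≋ (λ i → solve 3 (λ a s t → s :+ (:- a) :* t := s :- a :* t) refl a (s i (suc k)) _) ⟩
    (sum λ i → overLinear a (s i) (suc k)) ∎

  derivative : Sequence → Sequence
  derivative s k = number (+ suc k) * s (suc k)

  derivative-timesLinear : ∀ a s k →
    derivative (timesLinear a s) k ≈ a * s k + timesLinear a (derivative s) k
  derivative-timesLinear a s zero    = trans (*-congʳ φ.1#-homo) (trans
    (solve 3 (λ a s₁ s₀ → con 1ℚ :* (s₁ :+ a :* s₀) := a :* s₀ :+ con 1ℚ :* s₁) refl a (s 1) (s 0))
    (+-congˡ (*-congʳ (sym φ.1#-homo))))
  derivative-timesLinear a s (suc k) = begin
    number (+ suc (suc k)) * (s₂ + a * s₁)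
      ≈⟨ *-congʳ (number-suc (suc k)) ⟩
    (1# + number (+ suc k)) * (s₂ + a * s₁)
      ≈⟨ solve 4 (λ a s₂ s₁ N → (con 1ℚ :+ N) :* (s₂ :+ a :* s₁)
                             := a :* s₁ :+ ((con 1ℚ :+ N) :* s₂ :+ a :* (N :* s₁)))
           refl a s₂ s₁ (number (+ suc k)) ⟩
    a * s₁ + ((1# + number (+ suc k)) * s₂ + a * (number (+ suc k) * s₁))
      ≈⟨ +-congˡ (+-congʳ (*-congʳ (number-suc (suc k)))) ⟨
    a * s₁ + (number (+ suc (suc k)) * s₂ + a * (number (+ suc k) * s₁)) ∎
    where
    s₂ s₁ : Carrier
    s₂ = s (suc (suc k))
    s₁ = s (suc k)

  -- The quotient rule: for r = s / (1 + aT), differentiate s = (1 + aT) r and divide the result by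
  -- 1 + aT.
  overLinear-derivative : ∀ a s k →
    overLinear a (derivative s) k ≈ a * overLinear a (overLinear a s) k + derivative (overLinear a s) k
  overLinear-derivative a s k = begin
    overLinear a (derivative s) k
      ≈⟨ overLinear-cong a (λ j → *-congˡ (timesLinear-overLinear a s (suc j))) k ⟨
    overLinear a (derivative (timesLinear a r)) k
      ≈⟨ overLinear-cong a (λ j → derivative-timesLinear a r j) k ⟩
    overLinear a (λ j → a * r j + timesLinear a (derivative r) j) k
      ≈⟨ overLinear-+ (λ j → a * r j) (timesLinear a (derivative r)) k ⟩
    overLinear a (λ j → a * r j) k + overLinear a (timesLinear a (derivative r)) k
      ≈⟨ +-cong (overLinear-* a a r k) (overLinear-timesLinear a (derivative r) k) ⟩
    a * overLinear a r k + derivative r k ∎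
    where
    r : Sequence
    r = overLinear a s
    overLinear-+ : ∀ s t k → overLinear a (λ j → s j + t j) k ≈ overLinear a s k + overLinear a t k
    overLinear-+ s t zero    = refl
    overLinear-+ s t (suc k) = trans (+-congˡ (-‿cong (*-congˡ (overLinear-+ s t k))))
      (solve 5 (λ a s t p q → s :+ t :- a :* (p :+ q) := (s :- a :* p) :+ (t :- a :* q))
        refl a (s (suc k)) (t (suc k)) (overLinear a s k) (overLinear a t k))

  -- The generating function and its logarithmic derivative

  elementary : Vector Carrier n → Sequence
  elementary v k = e rawRing (+ k) v

  private
    productSum : List (List Carrier) → Carrier
    productSum as = foldr _+_ 0# (map (foldr _*_ 1#) as)

    productSum-++ : ∀ as bs → productSum (as ++ bs) ≈ productSum as + productSum bs
    productSum-++ []       bs = sym (+-identityˡ _)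
    productSum-++ (a ∷ as) bs = trans (+-congˡ (productSum-++ as bs)) (sym (+-assoc _ _ _))

    productSum-∷ : ∀ a as → productSum (map (a ∷_) as) ≈ a * productSum as
    productSum-∷ a []       = sym (zeroʳ a)
    productSum-∷ a (b ∷ as) = trans (+-congˡ (productSum-∷ a as)) (sym (distribˡ _ _ _))

  elementary-0 : ∀ (v : Vector Carrier n) → elementary v 0 ≈ 1#
  elementary-0 v = +-identityʳ 1#

  -- Sublists either contain the head or avoid it. Hence `elementary v` is the coefficient sequence
  -- of the product of all 1 + vᵢ T.
  elementary-∷ : ∀ (v : Vector Carrier (suc n)) k →
    elementary v k ≈ timesLinear (head v) (elementary (tail v)) k
  elementary-∷ v zero    = refl
  elementary-∷ v (suc k) = trans
    (productSum-++ (map (head v ∷_) (choose k (toList (tail v)))) (choose (suc k) (toList (tail v))))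
    (trans (+-congʳ (productSum-∷ (head v) (choose k (toList (tail v))))) (+-comm _ _))

  -- `choose` works from the front of the list, whereas `Φ` leaves out the last variable; the last
  -- linear factor is reached because linear factors commute.
  elementary-∷ʳ : ∀ (v : Vector Carrier (suc n)) k →
    elementary v k ≈ timesLinear (v (fromℕ n)) (elementary (λ i → v (inject₁ i))) k
  elementary-∷ʳ {zero}  v k = elementary-∷ v k
  elementary-∷ʳ {suc n} v k = begin
    elementary v k
      ≈⟨ elementary-∷ v k ⟩
    timesLinear (head v) (elementary (tail v)) k
      ≈⟨ timesLinear-cong (head v) (elementary-∷ʳ (tail v)) k ⟩
    timesLinear (head v) (timesLinear l (elementary (λ i → tail v (inject₁ i)))) k
      ≈⟨ timesLinear-comm (head v) l (elementary (λ i → tail v (inject₁ i))) k ⟩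
    timesLinear l (timesLinear (head v) (elementary (λ i → tail v (inject₁ i)))) k
      ≈⟨ timesLinear-cong l (elementary-∷ (λ i → v (inject₁ i))) k ⟨
    timesLinear l (elementary (λ i → v (inject₁ i))) k ∎
    where
    l : Carrier
    l = v (fromℕ (suc n))

  elementary-init : ∀ (v : Vector Carrier (suc n)) k →
    overLinear (v (fromℕ n)) (elementary v) k ≈ elementary (λ i → v (inject₁ i)) k
  elementary-init {n} v k = trans (overLinear-cong (v (fromℕ n)) (elementary-∷ʳ v) k)
    (overLinear-timesLinear (v (fromℕ n)) (elementary (λ i → v (inject₁ i))) k)

  -- overLinear (v i) (elementary v) is the sequence of elementary symmetric
  -- polynomials in the entries of v other than v i.
  weightedSum : Vector Carrier n → Vector Carrier n → Sequence
  weightedSum c v k = sum λ i → c i * overLinear (v i) (elementary v) k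

  weightedSum-∷ : ∀ (c v : Vector Carrier (suc n)) k →
    weightedSum c v k ≈ head c * elementary (tail v) k + timesLinear (head v) (weightedSum (tail c) (tail v)) k
  weightedSum-∷ c v k = +-cong
    (*-congˡ (trans (overLinear-cong (head v) (elementary-∷ v) k)
                    (overLinear-timesLinear (head v) (elementary (tail v)) k)))
    (trans (sum-cong-≋ λ i → *-congˡ {tail c i} (trans
             (overLinear-cong (tail v i) (elementary-∷ v) k)
             (overLinear-timesLinear-comm (head v) (tail v i) (elementary (tail v)) k)))
           (factor k))
    where
    r : Fin _ → Sequence
    r i = overLinear (tail v i) (elementary (tail v))
    factor : ∀ k → (sum λ i → tail c i * timesLinear (head v) (r i) k)
                 ≈ timesLinear (head v) (weightedSum (tail c) (tail v)) k
    factor zero    = refl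
    factor (suc k) = trans
      (sum-cong-≋ λ i → solve 4 (λ c a p q → c :* (p :+ a :* q) := c :* p :+ a :* (c :* q))
        refl (tail c i) (head v) (r i (suc k)) (r i k))
      (sum-+-* (head v) (λ i → tail c i * r i (suc k)) (λ i → tail c i * r i k))

  -- For E the product of the 1 + vᵢ T this is E′ = Σ vᵢ E / (1 + vᵢ T), the logarithmic derivative
  -- of a product.
  weightedSum-self : ∀ (v : Vector Carrier n) k → weightedSum v v k ≈ derivative (elementary v) k
  weightedSum-self {zero}  v k = sym (zeroʳ _)
  weightedSum-self {suc n} v k = begin
    weightedSum v v k
      ≈⟨ weightedSum-∷ v v k ⟩
    head v * elementary (tail v) k + timesLinear (head v) (weightedSum (tail v) (tail v)) k
      ≈⟨ +-congˡ (timesLinear-cong (head v) (weightedSum-self (tail v)) k) ⟩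
    head v * elementary (tail v) k + timesLinear (head v) (derivative (elementary (tail v))) k
      ≈⟨ derivative-timesLinear (head v) (elementary (tail v)) k ⟨
    derivative (timesLinear (head v) (elementary (tail v))) k
      ≈⟨ *-congˡ (elementary-∷ v (suc k)) ⟨
    derivative (elementary v) k ∎

  sum-const : ∀ n c → (sum λ (_ : Fin n) → c) ≈ number (+ n) * c
  sum-const zero    c = sym (trans (*-congʳ φ.0#-homo) (zeroˡ c))
  sum-const (suc n) c = trans (+-congˡ (sum-const n c)) (trans
    (solve 2 (λ N c → c :+ N :* c := (con 1ℚ :+ N) :* c) refl (number (+ n)) c)
    (*-congʳ (sym (number-suc n))))

  -- The sequence `s` is arbitrary since the lemma serves twice: for `elementary v`, and for that
  -- sequence already divided by one linear factor.
  sum-overLinear-suc : ∀ (v : Vector Carrier n) s k →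
    (sum λ i → overLinear (v i) s (suc k)) ≈
    number (+ n) * s (suc k) - (sum λ i → v i * overLinear (v i) s k)
  sum-overLinear-suc {n} v s k = begin
    (sum λ i → s (suc k) - f i)
      ≈⟨ sum-cong-≋ (λ i → solve 2 (λ s f → s :- f := s :+ (:- con 1ℚ) :* f) refl (s (suc k)) (f i)) ⟩
    (sum λ i → s (suc k) + - 1# * f i)
      ≈⟨ sum-+-* (- 1#) (λ _ → s (suc k)) f ⟩
    (sum λ (_ : Fin n) → s (suc k)) + - 1# * sum f
      ≈⟨ +-cong (sum-const n (s (suc k))) (solve 1 (λ t → (:- con 1ℚ) :* t := :- t) refl (sum f)) ⟩
    number (+ n) * s (suc k) - sum f ∎
    where
    f : Vector Carrier n
    f i = v i * overLinear (v i) s k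

  sum-overLinear-elementary : ∀ (v : Vector Carrier n) k →
    (sum λ i → overLinear (v i) (elementary v) k) ≈ (number (+ n) - number (+ k)) * elementary v k
  sum-overLinear-elementary {n} v zero    = trans (sum-const n (elementary v 0))
    (*-congʳ (sym (trans (+-congˡ (trans (-‿cong φ.0#-homo) -0#≈0#)) (+-identityʳ _))))
  sum-overLinear-elementary {n} v (suc k) = begin
    (sum λ i → overLinear (v i) (elementary v) (suc k))
      ≈⟨ sum-overLinear-suc v (elementary v) k ⟩
    number (+ n) * E₊ - weightedSum v v k
      ≈⟨ +-congˡ (-‿cong (weightedSum-self v k)) ⟩
    number (+ n) * E₊ - number (+ suc k) * E₊
      ≈⟨ solve 3 (λ N K E → N :* E :- K :* E := (N :- K) :* E) refl (number (+ n)) (number (+ suc k)) E₊ ⟩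
    (number (+ n) - number (+ suc k)) * E₊ ∎
    where
    E₊ : Carrier
    E₊ = elementary v (suc k)

  -- The quotients hₐ_b and their sums

  module _ (v : Vector Carrier n) (k : ℕ) where

    private
      E : Sequence
      E = elementary v
      R₁ : Fin n → Sequence
      R₁ b = overLinear (v b) E
      R₂ : Fin n → Fin n → Sequence
      R₂ a b = overLinear (v a) (R₁ b)
      N K : Carrier
      N = number (+ n)
      K = number (+ k)

    -- hₐ_b for v = y; a divided difference by pairTerm-difference.
    pairTerm : Fin n → Fin n → Carrier
    pairTerm a b = v a * R₂ a b k + v b * R₁ b k - R₂ a b k

    -- At v = y the right side is V xₐ - V x_b, and `v b - v a` is xₐ - x_b. So this is the
    -- divisibility that `pairTerm` is made for, in multiplied-out form.
    pairTerm-difference : ∀ a b →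
      (v b - v a) * pairTerm a b ≈ (1# - v a) * (v a * R₁ a k) - (1# - v b) * (v b * R₁ b k)
    pairTerm-difference a b = begin
      (v b - v a) * pairTerm a b
        ≈⟨ solve 4 (λ a b p r → (b :- a) :* (a :* p :+ b :* r :- p)
                             := (a :- con 1ℚ) :* ((b :- a) :* p) :+ (b :- a) :* (b :* r))
             refl (v a) (v b) (R₂ a b k) (R₁ b k) ⟩
      (v a - 1#) * ((v b - v a) * R₂ a b k) + (v b - v a) * (v b * R₁ b k)
        ≈⟨ +-congʳ (*-congˡ (overLinear-partialFractions (v a) (v b) E k)) ⟩
      (v a - 1#) * (v b * R₁ b k - v a * R₁ a k) + (v b - v a) * (v b * R₁ b k)
        ≈⟨ solve 4 (λ a b r q → (a :- con 1ℚ) :* (b :* r :- a :* q) :+ (b :- a) :* (b :* r)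
                             := (con 1ℚ :- a) :* (a :* q) :- (con 1ℚ :- b) :* (b :* r))
             refl (v a) (v b) (R₁ b k) (R₁ a k) ⟩
      (1# - v a) * (v a * R₁ a k) - (1# - v b) * (v b * R₁ b k) ∎

    -- The formula of `pairTerm` singles out `b`; partial fractions trade `v b * R₁ b k` for
    -- `v a * R₁ a k`. Cancelling `v b - v a` in `pairTerm-difference` is not possible for arbitrary
    -- entries of `v`.
    pairTerm-sym : ∀ a b → pairTerm a b ≈ pairTerm b a
    pairTerm-sym a b = begin
      v a * R₂ a b k + v b * R₁ b k - R₂ a b k
        ≈⟨ solve 5 (λ a b p r q → a :* p :+ b :* r :- p
                               := b :* p :+ a :* q :- p :+ (b :* r :- a :* q :- (b :- a) :* p))
             refl (v a) (v b) (R₂ a b k) (R₁ b k) (R₁ a k) ⟩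
      v b * R₂ a b k + v a * R₁ a k - R₂ a b k + (v b * R₁ b k - v a * R₁ a k - (v b - v a) * R₂ a b k)
        ≈⟨ +-congˡ (+-congˡ (-‿cong (overLinear-partialFractions (v a) (v b) E k))) ⟩
      v b * R₂ a b k + v a * R₁ a k - R₂ a b k + (v b * R₁ b k - v a * R₁ a k - (v b * R₁ b k - v a * R₁ a k))
        ≈⟨ trans (+-congˡ (-‿inverseʳ _)) (+-identityʳ _) ⟩
      v b * R₂ a b k + v a * R₁ a k - R₂ a b k
        ≈⟨ +-cong (+-congʳ (*-congˡ R₂-comm)) (-‿cong R₂-comm) ⟩
      v b * R₂ b a k + v a * R₁ a k - R₂ b a k ∎
      where
      R₂-comm : R₂ a b k ≈ R₂ b a k
      R₂-comm = overLinear-comm (v a) (v b) E k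

    -- The sum of `pairTerm a b` over all a ≠ b: the two terms with e^{ab} are summed by the
    -- identities for the n - 1 entries other than `v b`, and the term `v b * R₁ b k` occurs n - 1
    -- times.
    offDiagonalSum : Fin n → Carrier
    offDiagonalSum b = derivative (R₁ b) k + (N - 1#) * (v b * R₁ b k) - (N - 1# - K) * R₁ b k

    private
      -- The sum includes a = b, where the generating function is divided twice by the same factor
      -- and `R₂ b b` is no elementary symmetric polynomial. This spurious term reassembles to
      -- `pairTerm b b` in `sum-pairTerm` and is subtracted afterwards.
      sum-*R₂ : ∀ b k → (sum λ a → v a * R₂ a b k) ≈ v b * R₂ b b k + derivative (R₁ b) k
      sum-*R₂ b k = begin
        (sum λ a → v a * R₂ a b k)
          ≈⟨ sum-cong-≋ (λ a → trans (*-congˡ (overLinear-comm (v a) (v b) E k))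
               (sym (overLinear-* (v b) (v a) (R₁ a) k))) ⟩
        (sum λ a → overLinear (v b) (λ j → v a * R₁ a j) k)
          ≈⟨ overLinear-sum (v b) (λ a j → v a * R₁ a j) k ⟨
        overLinear (v b) (weightedSum v v) k
          ≈⟨ overLinear-cong (v b) (weightedSum-self v) k ⟩
        overLinear (v b) (derivative E) k
          ≈⟨ overLinear-derivative (v b) E k ⟩
        v b * R₂ b b k + derivative (R₁ b) k ∎

      sum-R₂ : ∀ b k → (sum λ a → R₂ a b k) ≈ (N - 1# - number (+ k)) * R₁ b k + R₂ b b k
      sum-R₂ b zero    = trans (sum-const n (R₁ b 0))
        (solve 2 (λ N r → N :* r := (N :- con 1ℚ :- con 0ℚ) :* r :+ r) refl N (R₁ b 0))
      sum-R₂ b (suc k) = begin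
        (sum λ a → R₂ a b (suc k))
          ≈⟨ sum-overLinear-suc v (R₁ b) k ⟩
        N * R₁ b (suc k) - (sum λ a → v a * R₂ a b k)
          ≈⟨ +-congˡ (-‿cong (sum-*R₂ b k)) ⟩
        N * R₁ b (suc k) - (v b * R₂ b b k + number (+ suc k) * R₁ b (suc k))
          ≈⟨ solve 5 (λ N K b r q → N :* r :- (b :* q :+ K :* r)
                                 := (N :- con 1ℚ :- K) :* r :+ (r :- b :* q))
               refl N (number (+ suc k)) (v b) (R₁ b (suc k)) (R₂ b b k) ⟩
        (N - 1# - number (+ suc k)) * R₁ b (suc k) + R₂ b b (suc k) ∎

    sum-pairTerm : ∀ b → (sum λ a → pairTerm a b) ≈ pairTerm b b + offDiagonalSum b
    sum-pairTerm b = begin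
      (sum λ a → pairTerm a b)
        ≈⟨ sum-cong-≋ (λ a → solve 3 (λ p c q → p :+ c :- q := (c :+ (:- con 1ℚ) :* q) :+ con 1ℚ :* p)
             refl (v a * R₂ a b k) c (R₂ a b k)) ⟩
      (sum λ a → c + - 1# * R₂ a b k + 1# * (v a * R₂ a b k))
        ≈⟨ sum-+-* 1# (λ a → c + - 1# * R₂ a b k) (λ a → v a * R₂ a b k) ⟩
      (sum λ a → c + - 1# * R₂ a b k) + 1# * (sum λ a → v a * R₂ a b k)
        ≈⟨ +-cong (sum-+-* (- 1#) (λ _ → c) (λ a → R₂ a b k)) (*-congˡ (sum-*R₂ b k)) ⟩
      (sum λ (_ : Fin n) → c) + - 1# * (sum λ a → R₂ a b k) + 1# * (v b * R₂ b b k + d)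
        ≈⟨ +-congʳ (+-cong (sum-const n c) (*-congˡ (sum-R₂ b k))) ⟩
      N * c + - 1# * ((N - 1# - K) * R₁ b k + R₂ b b k) + 1# * (v b * R₂ b b k + d)
        ≈⟨ solve 6 (λ N K b r q d → N :* (b :* r) :+ (:- con 1ℚ) :* ((N :- con 1ℚ :- K) :* r :+ q)
                                      :+ con 1ℚ :* (b :* q :+ d)
                   := b :* q :+ b :* r :- q :+ (d :+ (N :- con 1ℚ) :* (b :* r) :- (N :- con 1ℚ :- K) :* r))
             refl N K (v b) (R₁ b k) (R₂ b b k) d ⟩
      pairTerm b b + offDiagonalSum b ∎
      where
      c d : Carrier
      c = v b * R₁ b k
      d = derivative (R₁ b) k

    sum-offDiagonalSum : sum offDiagonalSum ≈
      number (+ suc k) * ((N - number (+ suc k)) * E (suc k))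
        + (N - 1#) * derivative E k - (N - 1# - K) * ((N - K) * E k)
    sum-offDiagonalSum = begin
      sum offDiagonalSum
        ≈⟨ sum-cong-≋ (λ b → solve 5 (λ K₊ c r₊ d r → K₊ :* r₊ :+ c :* d :- r
                                   := :- r :+ c :* d :+ K₊ :* r₊)
             refl (number (+ suc k)) (N - 1#) (R₁ b (suc k)) (v b * R₁ b k) ((N - 1# - K) * R₁ b k)) ⟩
      (sum λ b → - ((N - 1# - K) * R₁ b k) + (N - 1#) * (v b * R₁ b k) + number (+ suc k) * R₁ b (suc k))
        ≈⟨ sum-+-* (number (+ suc k)) _ (λ b → R₁ b (suc k)) ⟩
      (sum λ b → - ((N - 1# - K) * R₁ b k) + (N - 1#) * (v b * R₁ b k)) + number (+ suc k) * (sum λ b → R₁ b (suc k))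
        ≈⟨ +-congʳ (sum-+-* (N - 1#) (λ b → - ((N - 1# - K) * R₁ b k)) (λ b → v b * R₁ b k)) ⟩
      (sum λ b → - ((N - 1# - K) * R₁ b k)) + (N - 1#) * weightedSum v v k + number (+ suc k) * (sum λ b → R₁ b (suc k))
        ≈⟨ +-cong (+-cong
             (trans (sum-cong-≋ λ b → solve 2 (λ c r → :- (c :* r) := (:- c) :* r) refl (N - 1# - K) (R₁ b k))
                    (trans (sym (*-distribˡ-sum (- (N - 1# - K)) (λ b → R₁ b k)))
                           (*-congˡ (sum-overLinear-elementary v k))))
             (*-congˡ (weightedSum-self v k)))
             (*-congˡ (sum-overLinear-elementary v (suc k))) ⟩
      - (N - 1# - K) * ((N - K) * E k) + (N - 1#) * derivative E k
        + number (+ suc k) * ((N - number (+ suc k)) * E (suc k))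
        ≈⟨ solve 4 (λ c p q r → (:- c) :* p :+ q :+ r := r :+ q :- c :* p)
             refl (N - 1# - K) ((N - K) * E k) ((N - 1#) * derivative E k)
             (number (+ suc k) * ((N - number (+ suc k)) * E (suc k))) ⟩
      number (+ suc k) * ((N - number (+ suc k)) * E (suc k))
        + (N - 1#) * derivative E k - (N - 1# - K) * ((N - K) * E k) ∎

  -- Sums over pairs i < j

  -- The additive counterpart of `factor<`: a factor 1 has logarithmic derivative 0.
  upper : (i j : Fin n) → Carrier → Carrier
  upper i j c = if does (i <? j) then c else 0#

  sum-single : ∀ (f : Vector Carrier n) i → (∀ j → j ≢ i → f j ≈ 0#) → sum f ≈ f i
  sum-single {suc n} f zero    p = trans
    (+-congˡ (trans (sum-cong-≋ (λ j → p (suc j) λ ())) (sum-zero n))) (+-identityʳ _)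
    where
    sum-zero : ∀ n → (sum λ (_ : Fin n) → 0#) ≈ 0#
    sum-zero n = trans (sum-const n 0#) (zeroʳ _)
  sum-single {suc n} f (suc i) p = trans
    (+-cong (p zero λ ()) (sum-single (tail f) i (λ j j≢i → p (suc j) (λ { ≡.refl → j≢i ≡.refl }))))
    (+-identityˡ _)

  -- By symmetry, exchanging the order of summation carries the part below the diagonal to the part
  -- above it. The result stays doubled here and is halved only where ½ is available as a constant
  -- of the solver.
  sum-upper : ∀ (h : Fin n → Fin n → Carrier) → (∀ i j → h i j ≈ h j i) →
    (sum λ i → sum λ j → h i j) ≈
    (sum λ i → h i i) + ((sum λ i → sum λ j → upper i j (h i j)) + (sum λ i → sum λ j → upper i j (h i j)))
  sum-upper {n} h h-sym = begin
    (sum λ i → sum λ j → h i j)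
      ≈⟨ sum-cong-≋ (λ i → trans (sum-cong-≋ (trichotomy i))
           (trans (∑-distrib-+ (diagonal i) (λ j → U i j + U j i))
             (+-cong (diagonal-sum i) (∑-distrib-+ (U i) (λ j → U j i))))) ⟩
    (sum λ i → h i i + ((sum λ j → U i j) + (sum λ j → U j i)))
      ≈⟨ trans (∑-distrib-+ (λ i → h i i) _) (+-congˡ (∑-distrib-+ (λ i → sum (U i)) _)) ⟩
    (sum λ i → h i i) + ((sum λ i → sum λ j → U i j) + (sum λ i → sum λ j → U j i))
      ≈⟨ +-congˡ (+-congˡ (∑-comm (λ i j → U j i))) ⟩
    (sum λ i → h i i) + ((sum λ i → sum λ j → U i j) + (sum λ i → sum λ j → U i j)) ∎
    where
    U diagonal : Fin n → Fin n → Carrier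
    U i j = upper i j (h i j)
    diagonal i j = if does (i ≟ j) then h i j else 0#
    trichotomy : ∀ i j → h i j ≈ diagonal i j + (U i j + U j i)
    trichotomy i j with <-cmp i j
    ... | tri< i<j i≢j j≮i
      rewrite dec-false (i ≟ j) i≢j | dec-true (i <? j) i<j | dec-false (j <? i) j≮i =
      sym (trans (+-identityˡ _) (+-identityʳ _))
    ... | tri≈ i≮j i≡j j≮i
      rewrite dec-true (i ≟ j) i≡j | dec-false (i <? j) i≮j | dec-false (j <? i) j≮i =
      sym (trans (+-congˡ (+-identityˡ _)) (+-identityʳ _))
    ... | tri> i≮j i≢j j<i
      rewrite dec-false (i ≟ j) i≢j | dec-false (i <? j) i≮j | dec-true (j <? i) j<i =
      trans (h-sym i j) (sym (trans (+-identityˡ _) (+-identityˡ _)))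
    diagonal-sum : ∀ i → sum (diagonal i) ≈ h i i
    diagonal-sum i = trans (sum-single (diagonal i) i vanish) diagonal-ii
      where
      vanish : ∀ j → j ≢ i → diagonal i j ≈ 0#
      vanish j j≢i rewrite dec-false (i ≟ j) (λ i≡j → j≢i (≡.sym i≡j)) = refl
      diagonal-ii : diagonal i i ≈ h i i
      diagonal-ii rewrite dec-true (i ≟ i) ≡.refl = refl

-- The recurrence in an abstract differential ring

module LogarithmicDerivative
  (R : CommutativeRing 0ℓ 0ℓ) (φ : ℚ → CommutativeRing.Carrier R)
  (φ-isRingHomomorphism : IsRingHomomorphism ℚ.+-*-rawRing (CommutativeRing.rawRing R) φ)
  (D : Derivation R) where
  open CommutativeRing R hiding (zero)
  open RawSemiringDefs (RawRing.rawSemiring rawRing) using (_^_; product)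
  open SemiringSum semiring using (sum)
  open ℚ-Algebra R φ φ-isRingHomomorphism
  open Derivation D
  open SetoidReasoning setoid
  private
    module φ = IsRingHomomorphism φ-isRingHomomorphism
    variable
      n : ℕ
      l l′ m f f′ g : Carrier

  -- Logarithmic derivatives

  infix 4 _HasLog_

  -- `l` stands for ∂ f / f; in this form it makes sense for an `f` that is not invertible.
  _HasLog_ : Carrier → Carrier → Set
  f HasLog l = ∂ f ≈ l * f

  HasLog-cong : f ≈ f′ → l ≈ l′ → f HasLog l → f′ HasLog l′
  HasLog-cong f≈f′ l≈l′ p = trans (∂-cong (sym f≈f′)) (trans p (*-cong l≈l′ f≈f′))

  HasLog-* : f HasLog l → g HasLog m → f * g HasLog l + m
  HasLog-* {f} {l} {g} {m} p q = trans (leibniz f g) (trans (+-cong (*-congʳ p) (*-congˡ q))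
    (solve 4 (λ f l g m → l :* f :* g :+ f :* (m :* g) := (l :+ m) :* (f :* g)) refl f l g m))

  HasLog-1 : 1# HasLog 0#
  HasLog-1 = trans ∂-1 (sym (zeroˡ 1#))

  HasLog-^ : f HasLog l → ∀ k → f ^ k HasLog number (+ k) * l
  HasLog-^ {f} {l} p zero    = HasLog-cong refl (sym (trans (*-congʳ φ.0#-homo) (zeroˡ l))) HasLog-1
  HasLog-^ {f} {l} p (suc k) = HasLog-cong refl
    (trans (solve 2 (λ l K → l :+ K :* l := (con 1ℚ :+ K) :* l) refl l (number (+ k)))
           (*-congʳ (sym (number-suc k))))
    (HasLog-* p (HasLog-^ p k))

  HasLog-product : (f l : Vector Carrier n) → (∀ i → f i HasLog l i) → product f HasLog sum l
  HasLog-product {zero}  f l p = HasLog-1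
  HasLog-product {suc n} f l p = HasLog-* (p zero) (HasLog-product (tail f) (tail l) (λ i → p (suc i)))

  HasLog-product< : (f : (i j : Fin n) → .(i Fin.< j) → Carrier) (l : Fin n → Fin n → Carrier) →
    (∀ i j .(i<j : i Fin.< j) → f i j i<j HasLog l i j) →
    product< rawRing f HasLog sum λ i → sum λ j → upper i j (l i j)
  HasLog-product< f l p = HasLog-product _ _ λ i → HasLog-product _ _ λ j → factor i j
    where
    factor : ∀ i j → factor< rawRing f i j HasLog upper i j (l i j)
    factor i j with i <? j
    ... | yes i<j rewrite dec-true (i <? j) i<j = p i j i<j
    ... | no  i≮j rewrite dec-false (i <? j) i≮j = HasLog-1

  HasLog-inverse : f * g ≈ 1# → f HasLog l → g HasLog - l
  HasLog-inverse {f} {g} {l} fg≈1 p = begin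
    ∂ g                              ≈⟨ *-identityˡ (∂ g) ⟨
    1# * ∂ g                         ≈⟨ *-congʳ fg≈1 ⟨
    -- Adding and subtracting `l * (f * g) * g` makes ∂ (f * g) appear, which is ∂ 1 = 0.
    f * g * ∂ g                      ≈⟨ solve 4 (λ f g l d → f :* g :* d := (l :* f :* g :+ f :* d) :* g :- l :* (f :* g) :* g) refl f g l (∂ g) ⟩
    (l * f * g + f * ∂ g) * g - l * (f * g) * g
      ≈⟨ +-cong (*-congʳ (trans (+-congʳ (*-congʳ (sym p))) (trans (sym (leibniz f g)) (trans (∂-cong fg≈1) ∂-1))))
                (-‿cong (*-congʳ (*-congˡ fg≈1))) ⟩
    0# * g - l * 1# * g              ≈⟨ +-congʳ (zeroˡ g) ⟩
    0# - l * 1# * g                  ≈⟨ +-identityˡ _ ⟩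
    - (l * 1# * g)                   ≈⟨ solve 2 (λ l g → :- (l :* con 1ℚ :* g) := (:- l) :* g) refl l g ⟩
    - l * g                          ∎

  -- Derivatives of elementary symmetric polynomials

  -- The chain rule: e_{k+1} is affine in each entry, with partial derivative with respect to `v i`
  -- the k-th elementary symmetric polynomial of the other entries.
  ∂-elementary-suc : ∀ (v : Vector Carrier n) k →
    ∂ (elementary v (suc k)) ≈ weightedSum (λ i → ∂ (v i)) v k
  ∂-elementary-suc {zero}  v k = ∂-0
  ∂-elementary-suc {suc n} v k = begin
    ∂ (elementary v (suc k))
      ≈⟨ ∂-cong (elementary-∷ v (suc k)) ⟩
    ∂ (E (suc k) + v zero * E k)
      ≈⟨ trans (∂-+ _ _) (+-congˡ (leibniz _ _)) ⟩
    ∂ (E (suc k)) + (∂ (v zero) * E k + v zero * ∂ (E k))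
      ≈⟨ solve 3 (λ a b c → a :+ (b :+ c) := b :+ (a :+ c)) refl _ _ _ ⟩
    ∂ (v zero) * E k + (∂ (E (suc k)) + v zero * ∂ (E k))
      ≈⟨ +-congˡ (rest k) ⟩
    ∂ (v zero) * E k + timesLinear (v zero) (weightedSum (λ i → ∂ (v (suc i))) (tail v)) k
      ≈⟨ weightedSum-∷ (λ i → ∂ (v i)) v k ⟨
    weightedSum (λ i → ∂ (v i)) v k ∎
    where
    E : ℕ → Carrier
    E = elementary (tail v)
    rest : ∀ k → ∂ (E (suc k)) + v zero * ∂ (E k)
               ≈ timesLinear (v zero) (weightedSum (λ i → ∂ (v (suc i))) (tail v)) k
    rest zero    = trans (+-cong (∂-elementary-suc (tail v) 0)
      (trans (*-congˡ (trans (∂-cong (elementary-0 (tail v))) ∂-1)) (zeroʳ _))) (+-identityʳ _)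
    rest (suc k) = +-cong (∂-elementary-suc (tail v) (suc k)) (*-congˡ (∂-elementary-suc (tail v) k))

  -- The polynomial does not involve `v i`, but its definition by division does. In the induction
  -- the contribution `∂ (v i) * r k` of the full polynomial cancels against that of the subtracted
  -- term.
  ∂-overLinear-elementary : ∀ (v : Vector Carrier n) i → (∀ j → j ≢ i → ∂ (v j) ≈ 0#) →
    ∀ k → ∂ (overLinear (v i) (elementary v) k) ≈ 0#
  ∂-overLinear-elementary v i p zero    = trans (∂-cong (elementary-0 v)) ∂-1
  ∂-overLinear-elementary {n} v i p (suc k) = begin
    ∂ (elementary v (suc k) - v i * r k)
      ≈⟨ trans (∂-+ _ _) (+-congˡ (trans (∂-neg _) (-‿cong (leibniz _ _)))) ⟩
    ∂ (elementary v (suc k)) - (∂ (v i) * r k + v i * ∂ (r k))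
      ≈⟨ +-cong (trans (∂-elementary-suc v k) (sum-single _ i λ j j≢i → trans (*-congʳ (p j j≢i)) (zeroˡ _)))
                (-‿cong (+-congˡ (trans (*-congˡ (∂-overLinear-elementary v i p k)) (zeroʳ _)))) ⟩
    ∂ (v i) * r k - (∂ (v i) * r k + 0#)
      ≈⟨ trans (+-congˡ (-‿cong (+-identityʳ _))) (-‿inverseʳ _) ⟩
    0# ∎
    where
    r : ℕ → Carrier
    r = overLinear (v i) (elementary v)

module _
  (R : CommutativeRing 0ℓ 0ℓ) (φ : ℚ → CommutativeRing.Carrier R)
  (φ-isRingHomomorphism : IsRingHomomorphism ℚ.+-*-rawRing (CommutativeRing.rawRing R) φ) where
  open CommutativeRing R hiding (zero)
  open ℚ-Algebra R φ φ-isRingHomomorphism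
  open Derivation using (∂)
  open RingProperties ring using (-0#≈0#)
  open RawSemiringDefs (RawRing.rawSemiring rawRing) using (_^_; product)
  open SemiringSum semiring using (sum; sum-cong-≋; ∑-distrib-+; sum-init-last; *-distribˡ-sum; *-distribʳ-sum)
  open SetoidReasoning setoid
  private module φ = IsRingHomomorphism φ-isRingHomomorphism

  module Recurrence {m : ℕ}
    (θ : Fin (suc m) → Derivation R)
    (X : Fin (suc m) → ℤ → Carrier)
    (θ-X : ∀ i z → ∂ (θ i) (X i z) ≈ number z * X i z)
    (θ-X-≢ : ∀ {i j} z → i ≢ j → ∂ (θ i) (X j z) ≈ 0#)
    (X-+ : ∀ i v w → X i (v ℤ.+ w) ≈ X i v * X i w)
    (u : Fin (suc m) → Carrier)
    (u-inverse : ∀ i → (1# - X i 1ℤ) * u i ≈ 1#)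
    (w : (i j : Fin (suc m)) → .(i Fin.< j) → Carrier)
    (w-inverse : ∀ i j .(i<j : i Fin.< j) → (X i 1ℤ - X j 1ℤ) * w i j i<j ≈ 1#)
    (ℓ : ℕ) (t : ℤ) (k₁ k₂ k₃ : ℕ) where
    private
      n : ℕ
      n = suc m

    private
      X₁ Y r : Fin n → Carrier
      X₁ i = X i 1ℤ
      Y i = 1# - X₁ i
      r i = overLinear (Y i) (elementary Y) ℓ

    G : Fin n → Carrier
    G i = Y i * r i

    private
      h : Fin n → Fin n → Carrier
      h = pairTerm Y ℓ

      last : Fin n
      last = fromℕ m

    sumDerivation : Derivation R
    sumDerivation = record
      { ∂       = λ f → sum λ i → G i * ∂ (θ i) f
      ; ∂-cong  = λ p → sum-cong-≋ λ i → *-congˡ {G i} (Derivation.∂-cong (θ i) p)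
      ; ∂-+     = λ f g → trans
          (sum-cong-≋ λ i → trans (*-congˡ {G i} (Derivation.∂-+ (θ i) f g)) (distribˡ _ _ _))
          (∑-distrib-+ (λ i → G i * ∂ (θ i) f) (λ i → G i * ∂ (θ i) g))
      ; leibniz = λ f g → begin
          (sum λ i → G i * ∂ (θ i) (f * g))
            ≈⟨ sum-cong-≋ (λ i → trans (*-congˡ {G i} (Derivation.leibniz (θ i) f g))
                 (solve 5 (λ G f g f′ g′ → G :* (f′ :* g :+ f :* g′) := G :* f′ :* g :+ f :* (G :* g′))
                   refl (G i) f g (∂ (θ i) f) (∂ (θ i) g))) ⟩
          (sum λ i → G i * ∂ (θ i) f * g + f * (G i * ∂ (θ i) g))
            ≈⟨ sum-+-* f (λ i → G i * ∂ (θ i) f * g) (λ i → G i * ∂ (θ i) g) ⟩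
          (sum λ i → G i * ∂ (θ i) f * g) + f * (sum λ i → G i * ∂ (θ i) g)
            ≈⟨ +-congʳ (*-distribʳ-sum g (λ i → G i * ∂ (θ i) f)) ⟨
          (sum λ i → G i * ∂ (θ i) f) * g + f * (sum λ i → G i * ∂ (θ i) g) ∎
      }

    open Derivation sumDerivation using () renaming (∂ to V; ∂-+ to V-+; ∂-neg to V-neg; ∂-1 to V-1)
    open LogarithmicDerivative R φ φ-isRingHomomorphism sumDerivation
      using (_HasLog_; HasLog-cong; HasLog-*; HasLog-^; HasLog-product; HasLog-product<; HasLog-inverse)

    -- The factors of the integrand under V

    X-HasLog : ∀ i z → X i z HasLog G i * number z
    X-HasLog i z = begin
      V (X i z)                    ≈⟨ sum-single _ i (λ j j≢i → trans (*-congˡ {G j} (θ-X-≢ z j≢i)) (zeroʳ _)) ⟩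
      G i * ∂ (θ i) (X i z)            ≈⟨ trans (*-congˡ (θ-X i z)) (sym (*-assoc _ _ _)) ⟩
      G i * number z * X i z       ∎

    X₁-HasLog : ∀ i → X₁ i HasLog G i
    X₁-HasLog i = HasLog-cong refl (trans (*-congˡ φ.1#-homo) (*-identityʳ _)) (X-HasLog i 1ℤ)

    Y-HasLog : ∀ i → Y i HasLog - (X₁ i * r i)
    Y-HasLog i = begin
      V (1# - X₁ i)          ≈⟨ trans (V-+ 1# (- X₁ i)) (+-cong V-1 (trans (V-neg (X₁ i)) (-‿cong (X₁-HasLog i)))) ⟩
      0# - G i * X₁ i        ≈⟨ +-identityˡ _ ⟩
      - (G i * X₁ i)         ≈⟨ solve 3 (λ X Y r → :- (Y :* r :* X) := (:- (X :* r)) :* Y) refl (X₁ i) (Y i) (r i) ⟩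
      - (X₁ i * r i) * Y i   ∎

    u-HasLog : ∀ i → u i HasLog X₁ i * r i
    u-HasLog i = HasLog-cong refl (solve 1 (λ a → :- (:- a) := a) refl (X₁ i * r i))
      (HasLog-inverse (u-inverse i) (Y-HasLog i))

    X-X-HasLog : ∀ i j → X₁ i - X₁ j HasLog h i j
    X-X-HasLog i j = begin
      V (X₁ i - X₁ j)
        ≈⟨ trans (V-+ (X₁ i) (- X₁ j)) (+-cong (X₁-HasLog i) (trans (V-neg (X₁ j)) (-‿cong (X₁-HasLog j)))) ⟩
      G i * X₁ i - G j * X₁ j
        ≈⟨ solve 4 (λ x G x′ G′ → G :* x :- G′ :* x′
                               := (con 1ℚ :- (con 1ℚ :- x)) :* G :- (con 1ℚ :- (con 1ℚ :- x′)) :* G′)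
             refl (X₁ i) (G i) (X₁ j) (G j) ⟩
      (1# - Y i) * G i - (1# - Y j) * G j
        ≈⟨ pairTerm-difference Y ℓ i j ⟨
      (Y j - Y i) * h i j
        ≈⟨ solve 3 (λ x x′ h → (con 1ℚ :- x′ :- (con 1ℚ :- x)) :* h := h :* (x :- x′)) refl (X₁ i) (X₁ j) (h i j) ⟩
      h i j * (X₁ i - X₁ j) ∎

    w-HasLog : ∀ i j .(i<j : i Fin.< j) → w i j i<j HasLog - h i j
    w-HasLog i j i<j = HasLog-inverse (w-inverse i j i<j) (X-X-HasLog i j)

    -- Φₙ without the factor e_ℓ[Y - yₙ].
    core : ℤ → Carrier
    core t = product (λ i → X₁ i ^ k₁)
           * product (λ i → X₁ (inject₁ i) - X₁ last)
           * X last (ℤ.- t)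
           * product (λ i → u i ^ k₂)
           * product< rawRing (λ i j i<j → w i j i<j ^ k₃)

    private
      N K K₊ E₀ E₊ T κ₁ κ₂ κ₃ : Carrier
      N = number (+ n)
      K = number (+ ℓ)
      K₊ = number (+ suc ℓ)
      E₀ = elementary Y ℓ
      E₊ = elementary Y (suc ℓ)
      T = number t
      κ₁ = number (+ k₁)
      κ₂ = number (+ k₂)
      κ₃ = number (+ k₃)

    -- Summing the contributions

    sum-G : sum G ≈ K₊ * E₊
    sum-G = weightedSum-self Y ℓ

    sum-X*r : (sum λ i → X₁ i * r i) ≈ (N - K) * E₀ - K₊ * E₊
    sum-X*r = begin
      (sum λ i → X₁ i * r i)
        ≈⟨ sum-cong-≋ (λ i → solve 2 (λ x r → x :* r := r :+ (:- con 1ℚ) :* ((con 1ℚ :- x) :* r)) refl (X₁ i) (r i)) ⟩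
      (sum λ i → r i + - 1# * G i)
        ≈⟨ sum-+-* (- 1#) r G ⟩
      sum r + - 1# * sum G
        ≈⟨ +-cong (sum-overLinear-elementary Y ℓ) (*-congˡ sum-G) ⟩
      (N - K) * E₀ + - 1# * (K₊ * E₊)
        ≈⟨ solve 2 (λ a b → a :+ (:- con 1ℚ) :* b := a :- b) refl ((N - K) * E₀) (K₊ * E₊) ⟩
      (N - K) * E₀ - K₊ * E₊ ∎

    sum-h-last : (sum λ i → h (inject₁ i) last) ≈ offDiagonalSum Y ℓ last
    sum-h-last = begin
      (sum λ i → h (inject₁ i) last)
        -- The diagonal term completes the sum over i < n to one over all of `Fin n`, where
        -- `sum-pairTerm` applies.
        ≈⟨ solve 2 (λ s d → s := s :+ d :- d) refl _ (h last last) ⟩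
      (sum λ i → h (inject₁ i) last) + h last last - h last last
        ≈⟨ +-congʳ (trans (sym (sum-init-last (λ i → h i last))) (sum-pairTerm Y ℓ last)) ⟩
      h last last + offDiagonalSum Y ℓ last - h last last
        ≈⟨ solve 2 (λ d s → d :+ s :- d := s) refl (h last last) (offDiagonalSum Y ℓ last) ⟩
      offDiagonalSum Y ℓ last ∎

    private
      H : Carrier
      H = sum λ i → sum λ j → upper i j (h i j)

    sum-upper-h : H + H ≈ K₊ * ((N - K₊) * E₊) + (N - 1#) * (K₊ * E₊) - (N - 1# - K) * ((N - K) * E₀)
    sum-upper-h = begin
      H + H
        ≈⟨ solve 2 (λ d p → p := d :+ p :- d) refl (sum λ i → h i i) (H + H) ⟩
      (sum λ i → h i i) + (H + H) - (sum λ i → h i i)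
        ≈⟨ +-congʳ (sum-upper h (pairTerm-sym Y ℓ)) ⟨
      (sum λ i → sum λ j → h i j) - (sum λ i → h i i)
        ≈⟨ +-congʳ (sum-cong-≋ λ i → trans (sum-cong-≋ (pairTerm-sym Y ℓ i)) (sum-pairTerm Y ℓ i)) ⟩
      (sum λ i → h i i + offDiagonalSum Y ℓ i) - (sum λ i → h i i)
        ≈⟨ +-congʳ (∑-distrib-+ (λ i → h i i) (offDiagonalSum Y ℓ)) ⟩
      (sum λ i → h i i) + sum (offDiagonalSum Y ℓ) - (sum λ i → h i i)
        ≈⟨ solve 2 (λ d p → d :+ p :- d := p) refl (sum λ i → h i i) (sum (offDiagonalSum Y ℓ)) ⟩
      sum (offDiagonalSum Y ℓ)
        ≈⟨ sum-offDiagonalSum Y ℓ ⟩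
      K₊ * ((N - K₊) * E₊) + (N - 1#) * (K₊ * E₊) - (N - 1# - K) * ((N - K) * E₀) ∎

    core-HasLog : core t HasLog
      κ₁ * sum G + (sum λ i → h (inject₁ i) last) - T * G last + κ₂ * (sum λ i → X₁ i * r i) - κ₃ * H
    core-HasLog = HasLog-cong refl logs (HasLog-* (HasLog-* (HasLog-* (HasLog-*
      (HasLog-product _ (λ i → κ₁ * G i) λ i → HasLog-^ (X₁-HasLog i) k₁)
      (HasLog-product _ (λ i → h (inject₁ i) last) λ i → X-X-HasLog (inject₁ i) last))
      (X-HasLog last (ℤ.- t)))
      (HasLog-product _ (λ i → κ₂ * (X₁ i * r i)) λ i → HasLog-^ (u-HasLog i) k₂))
      (HasLog-product< _ (λ i j → κ₃ * - h i j) λ i j i<j → HasLog-^ (w-HasLog i j i<j) k₃))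
      where
      upper-neg : ∀ i j → upper i j (κ₃ * - h i j) ≈ - κ₃ * upper i j (h i j)
      upper-neg i j with does (i <? j)
      ... | true  = solve 2 (λ c d → c :* (:- d) := (:- c) :* d) refl κ₃ (h i j)
      ... | false = sym (zeroʳ (- κ₃))
      logs : (sum λ i → κ₁ * G i) + (sum λ i → h (inject₁ i) last) + G last * number (ℤ.- t)
           + (sum λ i → κ₂ * (X₁ i * r i)) + (sum λ i → sum λ j → upper i j (κ₃ * - h i j))
           ≈ κ₁ * sum G + (sum λ i → h (inject₁ i) last) - T * G last + κ₂ * (sum λ i → X₁ i * r i) - κ₃ * H
      logs = begin
        (sum λ i → κ₁ * G i) + S + G last * number (ℤ.- t) + (sum λ i → κ₂ * (X₁ i * r i))
          + (sum λ i → sum λ j → upper i j (κ₃ * - h i j))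
          ≈⟨ +-cong (+-cong (+-cong (+-congʳ (sym (*-distribˡ-sum κ₁ G))) (*-congˡ (number-neg t)))
                            (sym (*-distribˡ-sum κ₂ (λ i → X₁ i * r i))))
                    (trans (sum-cong-≋ λ i → trans (sum-cong-≋ (upper-neg i))
                             (sym (*-distribˡ-sum (- κ₃) (λ j → upper i j (h i j)))))
                           (sym (*-distribˡ-sum (- κ₃) (λ i → sum λ j → upper i j (h i j))))) ⟩
        κ₁ * sum G + S + G last * - T + κ₂ * (sum λ i → X₁ i * r i) + - κ₃ * H
          ≈⟨ solve 7 (λ p S G T q κ₃ H → p :+ S :+ G :* (:- T) :+ q :+ (:- κ₃) :* H
                                      := p :+ S :- T :* G :+ q :- κ₃ :* H)
               refl (κ₁ * sum G) S (G last) T (κ₂ * (sum λ i → X₁ i * r i)) κ₃ H ⟩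
        κ₁ * sum G + S - T * G last + κ₂ * (sum λ i → X₁ i * r i) - κ₃ * H ∎
        where
        S : Carrier
        S = sum λ i → h (inject₁ i) last

    private
      F : Carrier
      F = core t

    -- By the Leibniz rule the left side is V F plus F times the sum of all θᵢ Gᵢ + Gᵢ. Here θᵢ Gᵢ =
    -- - xᵢ rᵢ, because rᵢ is constant for θᵢ and θᵢ yᵢ = - xᵢ.
    sum-θ+1 : (sum λ i → ∂ (θ i) (G i * F) + G i * F) ≈
      (κ₁ * sum G + (sum λ i → h (inject₁ i) last) - T * G last + κ₂ * (sum λ i → X₁ i * r i) - κ₃ * H
        + sum G - (sum λ i → X₁ i * r i)) * F
    sum-θ+1 = begin
      (sum λ i → ∂ (θ i) (G i * F) + G i * F)
        ≈⟨ sum-cong-≋ (λ i → trans (+-congʳ (trans (Derivation.leibniz (θ i) (G i) F) (+-congʳ (*-congʳ (∂-G i)))))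
             (solve 4 (λ a F d G → (:- a) :* F :+ d :+ G :* F := d :+ F :* (G :+ (:- con 1ℚ) :* a))
               refl (X₁ i * r i) F (G i * ∂ (θ i) F) (G i))) ⟩
      (sum λ i → G i * ∂ (θ i) F + F * (G i + - 1# * (X₁ i * r i)))
        ≈⟨ sum-+-* F (λ i → G i * ∂ (θ i) F) (λ i → G i + - 1# * (X₁ i * r i)) ⟩
      V F + F * (sum λ i → G i + - 1# * (X₁ i * r i))
        ≈⟨ +-cong core-HasLog (*-congˡ (sum-+-* (- 1#) G (λ i → X₁ i * r i))) ⟩
      L * F + F * (sum G + - 1# * (sum λ i → X₁ i * r i))
        ≈⟨ solve 4 (λ L F g s → L :* F :+ F :* (g :+ (:- con 1ℚ) :* s) := (L :+ g :- s) :* F)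
             refl L F (sum G) (sum λ i → X₁ i * r i) ⟩
      (L + sum G - (sum λ i → X₁ i * r i)) * F ∎
      where
      L : Carrier
      L = κ₁ * sum G + (sum λ i → h (inject₁ i) last) - T * G last + κ₂ * (sum λ i → X₁ i * r i) - κ₃ * H
      ∂-G : ∀ i → ∂ (θ i) (G i) ≈ - (X₁ i * r i)
      ∂-G i = begin
        ∂ (θ i) (Y i * r i)
          ≈⟨ D.leibniz (Y i) (r i) ⟩
        ∂ (θ i) (Y i) * r i + Y i * ∂ (θ i) (r i)
          ≈⟨ +-cong (*-congʳ (trans (∂-Y i) (-‿cong (trans (θ-X i 1ℤ) (trans (*-congʳ φ.1#-homo) (*-identityˡ _))))))
               (*-congˡ (LogarithmicDerivative.∂-overLinear-elementary R φ φ-isRingHomomorphism (θ i) Y i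
                 (λ j j≢i → trans (∂-Y j) (trans (-‿cong (θ-X-≢ 1ℤ (λ i≡j → j≢i (≡.sym i≡j)))) -0#≈0#)) ℓ)) ⟩
        - X₁ i * r i + Y i * 0#
          ≈⟨ trans (+-congˡ (zeroʳ (Y i))) (+-identityʳ _) ⟩
        - X₁ i * r i
          ≈⟨ solve 2 (λ x r → (:- x) :* r := :- (x :* r)) refl (X₁ i) (r i) ⟩
        - (X₁ i * r i) ∎
        where
        module D = Derivation (θ i)
        ∂-Y : ∀ j → ∂ (θ i) (Y j) ≈ - ∂ (θ i) (X₁ j)
        ∂-Y j = trans (D.∂-+ 1# (- X₁ j)) (trans (+-cong D.∂-1 (D.∂-neg (X₁ j))) (+-identityˡ _))

    -- Expansion in the elementary symmetric polynomials of y₁ , ... , yₙ₋₁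

    private
      e₁ : ℤ → Carrier
      e₁ z = e rawRing z (λ i → Y (inject₁ i))

      yₙ xₙ e₊ e₀ e₋ : Carrier
      yₙ = Y last
      xₙ = X₁ last
      e₊ = e₁ (+ suc ℓ)
      e₀ = e₁ (+ ℓ)
      e₋ = e₁ (+ ℓ ℤ.- 1ℤ)

    -- V treats all n variables alike, whereas the integrands only contain polynomials in the first
    -- n - 1 of the y's; `E₊≈` and `E₀≈` pass from the former to the latter.
    E₊≈ : E₊ ≈ e₊ + yₙ * e₀
    E₊≈ = elementary-∷ʳ Y (suc ℓ)

    E₀≈ : E₀ ≈ e₀ + yₙ * e₋
    E₀≈ = expand ℓ
      where
      expand : ∀ k → elementary Y k ≈ e₁ (+ k) + yₙ * e₁ (+ k ℤ.- 1ℤ)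
      -- In degree 0 the index `+ 0 ℤ.- 1ℤ` reduces to -1, where `e` is 0# by definition, so the
      -- extra term vanishes.
      expand zero    = trans (elementary-∷ʳ Y 0) (sym (trans (+-congˡ (zeroʳ yₙ)) (+-identityʳ _)))
      expand (suc k) = elementary-∷ʳ Y (suc k)

    open Coefficients n (+ ℓ) t k₁ k₂ k₃ public

    private
      two three half : Carrier
      two   = number (+ 2)
      three = number (+ 3)
      half  = φ ½

      number-1 : number 1ℤ ≈ 1#
      number-1 = φ.1#-homo

      number-ℓ+1 : number (+ ℓ ℤ.+ 1ℤ) ≈ K + 1#
      number-ℓ+1 = trans (number-+ (+ ℓ) 1ℤ) (+-congˡ number-1)

      number-n-ℓ : number (+ n ℤ.- + ℓ) ≈ N - K
      number-n-ℓ = number-- (+ n) (+ ℓ)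

      factor-homo : ∀ a b c {a′ b′ c′} → number a ≈ a′ → number b ≈ b′ → number c ≈ c′ →
        φ (ι a ℚ.* (ι b ℚ.+ + k₃ ℚ./ 2 ℚ.* ι c)) ≈ a′ * (b′ + half * κ₃ * c′)
      factor-homo a b c p q r = trans (φ.*-homo _ _) (*-cong p (trans (φ.+-homo _ _) (+-cong q
        (trans (φ.*-homo _ _) (*-cong (trans (φ.⟦⟧-cong (k/2≡½*k (+ k₃))) (φ.*-homo ½ (ι (+ k₃)))) r)))))

      number-2n-2-ℓ : number (+ 2 ℤ.* + n ℤ.- + 2 ℤ.- + ℓ) ≈ N + N - two - K
      number-2n-2-ℓ = trans (number-- (+ 2 ℤ.* + n ℤ.- + 2) (+ ℓ)) (+-congʳ (trans (number-- (+ 2 ℤ.* + n) (+ 2))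
        (+-congʳ (trans (φ.⟦⟧-cong (≡.cong ι (double (+ n)))) (number-+ (+ n) (+ n))))))
        where
        double : ∀ i → + 2 ℤ.* i ≡ i ℤ.+ i
        double = solve-∀

      number-n-1-ℓ : number (+ n ℤ.- 1ℤ ℤ.- + ℓ) ≈ N - 1# - K
      number-n-1-ℓ = trans (number-- (+ n ℤ.- 1ℤ) (+ ℓ)) (+-congʳ (trans (number-- (+ n) 1ℤ) (+-congˡ (-‿cong number-1))))

      number-k₂-k₁-_ : ∀ c → number (+ k₂ ℤ.- + k₁ ℤ.- c) ≈ κ₂ - κ₁ - number c
      number-k₂-k₁- c = trans (number-- (+ k₂ ℤ.- + k₁) c) (+-congʳ (number-- (+ k₂) (+ k₁)))

      B C : Carrier
      B = (K + 1#) * (κ₂ - κ₁ - two + half * κ₃ * (N + N - two - K))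
      C = (N - K) * (κ₂ - two + half * κ₃ * (N - 1# - K))

      φ-B : φ (ι (+ ℓ ℤ.+ 1ℤ) ℚ.* (ι (+ k₂ ℤ.- + k₁ ℤ.- + 2) ℚ.+ + k₃ ℚ./ 2 ℚ.* ι (+ 2 ℤ.* + n ℤ.- + 2 ℤ.- + ℓ))) ≈ B
      φ-B = factor-homo (+ ℓ ℤ.+ 1ℤ) (+ k₂ ℤ.- + k₁ ℤ.- + 2) (+ 2 ℤ.* + n ℤ.- + 2 ℤ.- + ℓ)
        number-ℓ+1 (number-k₂-k₁- (+ 2)) number-2n-2-ℓ

      φ-A₊ : φ A₊ ≈ (K + 1#) * (κ₂ - κ₁ - three + half * κ₃ * (N + N - two - K))
      φ-A₊ = factor-homo (+ ℓ ℤ.+ 1ℤ) (+ k₂ ℤ.- + k₁ ℤ.- + 3) (+ 2 ℤ.* + n ℤ.- + 2 ℤ.- + ℓ)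
        number-ℓ+1 (number-k₂-k₁- (+ 3)) number-2n-2-ℓ

      φ-A₀ : φ A₀ ≈ T - N + B - C
      φ-A₀ = trans (φ.+-homo _ _) (+-cong
        (trans (φ.+-homo _ _) (+-cong (number-- t (+ n)) φ-B))
        (trans (φ.-‿homo _) (-‿cong (factor-homo (+ n ℤ.- + ℓ) (+ k₂ ℤ.- + 2) (+ n ℤ.- 1ℤ ℤ.- + ℓ)
          number-n-ℓ (number-- (+ k₂) (+ 2)) number-n-1-ℓ))))

      φ-Ā₀ : φ Ā₀ ≈ - (T - N + 1# + B)
      φ-Ā₀ = trans (φ.-‿homo _) (-‿cong (trans (φ.+-homo _ _)
        (+-cong (trans (number-+ (t ℤ.- + n) 1ℤ) (+-cong (number-- t (+ n)) number-1)) φ-B)))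

      φ-A₋ : φ A₋ ≈ - ((N - K) * (κ₂ - 1# + half * κ₃ * (N - 1# - K)))
      φ-A₋ = trans (φ.-‿homo _) (-‿cong (factor-homo (+ n ℤ.- + ℓ) (+ k₂ ℤ.- 1ℤ) (+ n ℤ.- 1ℤ ℤ.- + ℓ)
        number-n-ℓ (trans (number-- (+ k₂) 1ℤ) (+-congˡ (-‿cong number-1))) number-n-1-ℓ))

      φ-Ā₋ : φ Ā₋ ≈ (N - K) * (κ₂ - 1# + half * κ₃ * (N - 1# - K))
      φ-Ā₋ = trans (φ.-‿homo _) (trans (-‿cong φ-A₋) (solve 1 (λ a → :- (:- a) := a) refl _))

      offDiagonalSum-last : offDiagonalSum Y ℓ last ≈ (1# + K) * e₊ + (N - 1#) * (yₙ * e₀) - (N - 1# - K) * e₀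
      offDiagonalSum-last = +-cong (+-cong (*-cong (number-suc ℓ) (elementary-init Y (suc ℓ)))
        (*-congˡ (*-congˡ (elementary-init Y ℓ)))) (-‿cong (*-congˡ (elementary-init Y ℓ)))

      H≈ : H ≈ half * ((1# + K) * ((N - (1# + K)) * (e₊ + yₙ * e₀)) + (N - 1#) * ((1# + K) * (e₊ + yₙ * e₀))
                       - (N - 1# - K) * ((N - K) * (e₀ + yₙ * e₋)))
      -- `sum-upper-h` only evaluates `H + H`; this halving is the source of `half * κ₃`, that is
      -- k₃/2, in the coefficients.
      H≈ = trans (solve 1 (λ H → H := con ½ :* (H :+ H)) refl H) (*-congˡ (trans sum-upper-h
        (+-cong (+-cong (*-cong K₊≈ (*-cong (+-congˡ (-‿cong K₊≈)) E₊≈)) (*-congˡ (*-cong K₊≈ E₊≈)))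
                (-‿cong (*-congˡ (*-congˡ E₀≈))))))
        where
        K₊≈ : K₊ ≈ 1# + K
        K₊≈ = number-suc ℓ

      sum-G≈ : sum G ≈ (1# + K) * (e₊ + yₙ * e₀)
      sum-G≈ = trans sum-G (*-cong (number-suc ℓ) E₊≈)

      sum-X*r≈ : (sum λ i → X₁ i * r i) ≈ (N - K) * (e₀ + yₙ * e₋) - (1# + K) * (e₊ + yₙ * e₀)
      sum-X*r≈ = trans sum-X*r (+-cong (*-congˡ E₀≈) (-‿cong (*-cong (number-suc ℓ) E₊≈)))

      a₊ a₀ ā₀ a₋ : Carrier
      a₊ = (K + 1#) * (κ₂ - κ₁ - three + half * κ₃ * (N + N - two - K))
      a₀ = T - N + B - C
      ā₀ = - (T - N + 1# + B)
      a₋ = (N - K) * (κ₂ - 1# + half * κ₃ * (N - 1# - K))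

      -- Once every sum is expanded, both sides are combinations of `e₊`, `e₀` and `e₋` that are at
      -- most linear in `xₙ`, and what remains is a polynomial identity over ℚ.
      coefficient-identity :
        κ₁ * sum G + (sum λ i → h (inject₁ i) last) - T * G last + κ₂ * (sum λ i → X₁ i * r i) - κ₃ * H
          + sum G - (sum λ i → X₁ i * r i)
        ≈ - (a₊ * e₊ + a₀ * e₀ + ā₀ * (xₙ * e₀) + - a₋ * e₋ + a₋ * (xₙ * e₋))
      coefficient-identity = trans
        (+-cong (+-cong (+-cong (+-cong (+-cong (+-cong
          (*-congˡ sum-G≈)
          (trans sum-h-last offDiagonalSum-last))
          (-‿cong (*-congˡ (*-congˡ (elementary-init Y ℓ)))))
          (*-congˡ sum-X*r≈))
          (-‿cong (*-congˡ H≈)))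
          sum-G≈)
          (-‿cong sum-X*r≈))
        -- The numerals enter as solver constants, not as variables: the identity uses 2 = 1 + 1 and
        -- 3 = 1 + 1 + 1.
        (solve 10 (λ N K k₁ k₂ k₃ T x e₊ e₀ e₋ →
          let one   = con 1ℚ
              two   = con (ι (+ 2))
              three = con (ι (+ 3))
              half  = con ½
              y     = one :- x
              S     = (one :+ K) :* (e₊ :+ y :* e₀)
              Q     = (N :- K) :* (e₀ :+ y :* e₋) :- S
              B     = (K :+ one) :* (k₂ :- k₁ :- two :+ half :* k₃ :* (N :+ N :- two :- K))
              C     = (N :- K) :* (k₂ :- two :+ half :* k₃ :* (N :- one :- K))
              a₋    = (N :- K) :* (k₂ :- one :+ half :* k₃ :* (N :- one :- K))
          in k₁ :* S :+ ((one :+ K) :* e₊ :+ (N :- one) :* (y :* e₀) :- (N :- one :- K) :* e₀)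
               :- T :* (y :* e₀) :+ k₂ :* Q
               :- k₃ :* (half :* ((one :+ K) :* ((N :- (one :+ K)) :* (e₊ :+ y :* e₀)) :+ (N :- one) :* S
                                  :- (N :- one :- K) :* ((N :- K) :* (e₀ :+ y :* e₋))))
               :+ S :- Q
             := :- ((K :+ one) :* (k₂ :- k₁ :- three :+ half :* k₃ :* (N :+ N :- two :- K)) :* e₊
                    :+ (T :- N :+ B :- C) :* e₀
                    :+ (:- (T :- N :+ one :+ B)) :* (x :* e₀)
                    :+ (:- a₋) :* e₋ :+ a₋ :* (x :* e₋)))
          refl N K κ₁ κ₂ κ₃ T xₙ e₊ e₀ e₋)

    -- Bracketed exactly like `Φ`: over the iterated series the two agree by computation, so
    -- `recurrence` applies to `Φ` without rewriting.
    integrand : ℤ → ℤ → Carrier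
    integrand z t = e₁ z
      * product (λ i → X₁ i ^ k₁)
      * product (λ i → X₁ (inject₁ i) - X₁ last)
      * X last (ℤ.- t)
      * product (λ i → u i ^ k₂)
      * product< rawRing (λ i j i<j → w i j i<j ^ k₃)

    private
      integrand≈ : ∀ z t → integrand z t ≈ e₁ z * core t
      integrand≈ z t = solve 6 (λ e a b c d f → e :* a :* b :* c :* d :* f := e :* (a :* b :* c :* d :* f))
        refl _ _ _ _ _ _

      -- The exponent of xₙ is minus t, so lowering t by one multiplies by xₙ; this is what
      -- identifies the terms with `xₙ * e₀` and `xₙ * e₋`.
      integrand-pred : ∀ z → integrand z (t ℤ.- 1ℤ) ≈ e₁ z * (xₙ * F)
      integrand-pred z = trans
        (*-congʳ (*-congʳ (*-congˡ (trans (reflexive (≡.cong (X last) (regroup t))) (X-+ last 1ℤ (ℤ.- t))))))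
        (solve 7 (λ e a b xₙ c d f → e :* a :* b :* (xₙ :* c) :* d :* f := e :* (xₙ :* (a :* b :* c :* d :* f)))
          refl _ _ _ _ _ _ _)
        where
        regroup : ∀ t → ℤ.- (t ℤ.- 1ℤ) ≡ 1ℤ ℤ.+ ℤ.- t
        regroup = solve-∀

    integrand-negative : ∀ k t → integrand -[1+ k ] t ≈ 0#
    integrand-negative k t = trans (integrand≈ -[1+ k ] t) (zeroˡ (core t))

    recurrence : (sum λ i → ∂ (θ i) (G i * core t) + G i * core t) ≈
      - (φ A₊ * integrand (+ ℓ ℤ.+ 1ℤ) t
       + φ A₀ * integrand (+ ℓ) t
       + φ Ā₀ * integrand (+ ℓ) (t ℤ.- 1ℤ)
       + φ A₋ * integrand (+ ℓ ℤ.- 1ℤ) t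
       + φ Ā₋ * integrand (+ ℓ ℤ.- 1ℤ) (t ℤ.- 1ℤ))
    recurrence = begin
      (sum λ i → ∂ (θ i) (G i * core t) + G i * core t)
        ≈⟨ trans sum-θ+1 (*-congʳ coefficient-identity) ⟩
      - (a₊ * e₊ + a₀ * e₀ + ā₀ * (xₙ * e₀) + - a₋ * e₋ + a₋ * (xₙ * e₋)) * F
        ≈⟨ solve 9 (λ a₊ a₀ ā₀ a₋ xₙ e₊ e₀ e₋ F →
               (:- (a₊ :* e₊ :+ a₀ :* e₀ :+ ā₀ :* (xₙ :* e₀) :+ (:- a₋) :* e₋ :+ a₋ :* (xₙ :* e₋))) :* F
            := :- (a₊ :* (e₊ :* F) :+ a₀ :* (e₀ :* F) :+ ā₀ :* (e₀ :* (xₙ :* F))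
                   :+ (:- a₋) :* (e₋ :* F) :+ a₋ :* (e₋ :* (xₙ :* F))))
             refl a₊ a₀ ā₀ a₋ xₙ e₊ e₀ e₋ F ⟩
      - (a₊ * (e₊ * F) + a₀ * (e₀ * F) + ā₀ * (e₀ * (xₙ * F)) + - a₋ * (e₋ * F) + a₋ * (e₋ * (xₙ * F)))
        ≈⟨ -‿cong (+-cong (+-cong (+-cong (+-cong
             (*-cong φ-A₊ (trans (integrand≈ (+ ℓ ℤ.+ 1ℤ) t)
               (*-congʳ (reflexive (≡.cong e₁ (ℤ.+-comm (+ ℓ) 1ℤ))))))
             (*-cong φ-A₀ (integrand≈ (+ ℓ) t)))
             (*-cong φ-Ā₀ (integrand-pred (+ ℓ))))
             (*-cong φ-A₋ (integrand≈ (+ ℓ ℤ.- 1ℤ) t)))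
             (*-cong φ-Ā₋ (integrand-pred (+ ℓ ℤ.- 1ℤ)))) ⟨
      - (φ A₊ * integrand (+ ℓ ℤ.+ 1ℤ) t
       + φ A₀ * integrand (+ ℓ) t
       + φ Ā₀ * integrand (+ ℓ) (t ℤ.- 1ℤ)
       + φ A₋ * integrand (+ ℓ ℤ.- 1ℤ) t
       + φ Ā₋ * integrand (+ ℓ ℤ.- 1ℤ) (t ℤ.- 1ℤ)) ∎

-- The recurrence for residues

open import Data.Rational.Base using (_+_; _*_; 0ℚ)

module LaurentRecurrence (m k : ℕ) (t : ℤ) (k₁ k₂ k₃ : ℕ) = Recurrence
  (iteratedRing (suc m)) (scalar (suc m)) (scalar-isRingHomomorphism (suc m))
  (θ (suc m)) x^ (θ-x^ (suc m)) (θ-x^-≢ (suc m)) (x^-+ (suc m))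
  1/⟨1-x_⟩ (1/⟨1-x⟩-inverse (suc m)) 1/⟨x_-x_⟩ (1/⟨x-x⟩-inverse (suc m)) k t k₁ k₂ k₃

D-negative : ∀ m k t k₁ k₂ k₃ → D (suc m) -[1+ k ] t k₁ k₂ k₃ ≡ 0ℚ
D-negative m k t k₁ k₂ k₃ = ≡.trans
  (Res-cong (suc m) {Φ (suc m) -[1+ k ] t k₁ k₂ k₃} {RawRing.0# (iterated (suc m))} (integrand-negative k t))
  (Res-0 (suc m))
  -- `integrand` takes its degree as an argument of its own; 0 is a default for the degree of the
  -- module.
  where open LaurentRecurrence m 0 t k₁ k₂ k₃

recurrence-nonnegative : ∀ m (k₁ k₂ k₃ k : ℕ) (t : ℤ) →
  let n = suc m; ℓ = + k; open Coefficients n ℓ t k₁ k₂ k₃ in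
    A₊ * D n (ℓ ℤ.+ 1ℤ) t k₁ k₂ k₃
  + A₀ * D n ℓ t k₁ k₂ k₃
  + Ā₀ * D n ℓ (t ℤ.- 1ℤ) k₁ k₂ k₃
  + A₋ * D n (ℓ ℤ.- 1ℤ) t k₁ k₂ k₃
  + Ā₋ * D n (ℓ ℤ.- 1ℤ) (t ℤ.- 1ℤ) k₁ k₂ k₃
  ≡ 0ℚ
recurrence-nonnegative m k₁ k₂ k₃ k t = ≡.trans (≡.sym Res-combination)
  (≡.trans (≡.sym (neg-involutive (Res {n} combination)))
    (≡.cong ℚ.-_ (≡.trans (≡.sym (Res-neg n combination))
      (≡.trans (≡.sym (Res-cong n {sum f} {S.- combination} recurrence)) (Res-sum≡0 n f Res-f)))))
  where
  n : ℕ
  n = suc m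
  ℓ : ℤ
  ℓ = + k
  open RingProperties ℚ.+-*-ring using () renaming (-‿involutive to neg-involutive)
  open LaurentRecurrence m k t k₁ k₂ k₃
  open Derivation using (∂)
  module S = CommutativeRing (iteratedRing n)
  open SemiringSum S.semiring using (sum)
  f : Vector (Series n) n
  f i = ∂ (θ n i) (G i S.* core t) S.+ G i S.* core t
  Res-f : ∀ i → Res {n} (f i) ≡ 0ℚ
  -- The residue of θᵢ g is minus that of g, so the two summands cancel for each i separately.
  Res-f i = ≡.trans (Res-+ n (∂ (θ n i) (G i S.* core t)) (G i S.* core t))
    (≡.trans (≡.cong (_+ Res {n} (G i S.* core t)) (Res-θ n i (G i S.* core t)))
      (ℚ.+-inverseˡ (Res {n} (G i S.* core t))))
  Φ₊ Φ₀ Φ̄₀ Φ₋ Φ̄₋ sum₁ sum₂ sum₃ sum₄ combination : Series n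
  Φ₊ = Φ n (ℓ ℤ.+ 1ℤ) t k₁ k₂ k₃
  Φ₀ = Φ n ℓ t k₁ k₂ k₃
  Φ̄₀ = Φ n ℓ (t ℤ.- 1ℤ) k₁ k₂ k₃
  Φ₋ = Φ n (ℓ ℤ.- 1ℤ) t k₁ k₂ k₃
  Φ̄₋ = Φ n (ℓ ℤ.- 1ℤ) (t ℤ.- 1ℤ) k₁ k₂ k₃
  sum₁ = scalar n A₊ S.* Φ₊
  sum₂ = sum₁ S.+ scalar n A₀ S.* Φ₀
  sum₃ = sum₂ S.+ scalar n Ā₀ S.* Φ̄₀
  sum₄ = sum₃ S.+ scalar n A₋ S.* Φ₋
  combination = sum₄ S.+ scalar n Ā₋ S.* Φ̄₋
  Res-term : ∀ q f g {p} → Res {n} f ≡ p → Res {n} (f S.+ scalar n q S.* g) ≡ p + q * Res {n} g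
  Res-term q f g p = ≡.trans (Res-+ n f (scalar n q S.* g)) (≡.cong₂ _+_ p (Res-scalar n q g))
  Res-combination : Res {n} combination ≡ A₊ * Res {n} Φ₊ + A₀ * Res {n} Φ₀ + Ā₀ * Res {n} Φ̄₀
    + A₋ * Res {n} Φ₋ + Ā₋ * Res {n} Φ̄₋
  Res-combination =
    Res-term Ā₋ sum₄ Φ̄₋ (Res-term A₋ sum₃ Φ₋ (Res-term Ā₀ sum₂ Φ̄₀ (Res-term A₀ sum₁ Φ₀ (Res-scalar n A₊ Φ₊))))

a≡0⇒p+q*a≡0 : ∀ {p a} q → p ≡ 0ℚ → a ≡ 0ℚ → p + q * a ≡ 0ℚ
a≡0⇒p+q*a≡0 q ≡.refl ≡.refl = ≡.trans (ℚ.+-identityˡ (q * 0ℚ)) (ℚ.*-zeroʳ q)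

proposition4p4 : (n : ℕ) .{{_ : NonZero n}} → 3 ℕ.≤ n →
    (k₁ k₂ k₃ : ℕ) (ℓ t : ℤ) →
    let open Coefficients n ℓ t k₁ k₂ k₃ in
    A₊ * D n (ℓ ℤ.+ 1ℤ) t k₁ k₂ k₃
    + A₀ * D n ℓ t k₁ k₂ k₃
    + Ā₀ * D n ℓ (t ℤ.- 1ℤ) k₁ k₂ k₃
    + A₋ * D n (ℓ ℤ.- 1ℤ) t k₁ k₂ k₃
    + Ā₋ * D n (ℓ ℤ.- 1ℤ) (t ℤ.- 1ℤ) k₁ k₂ k₃
    ≡ 0ℚ
proposition4p4 (suc m) _ k₁ k₂ k₃ (+ k) t = recurrence-nonnegative m k₁ k₂ k₃ k t
proposition4p4 (suc m) _ k₁ k₂ k₃ ℓ@(-[1+ k ]) t =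
  a≡0⇒p+q*a≡0 Ā₋ (a≡0⇒p+q*a≡0 A₋ (a≡0⇒p+q*a≡0 Ā₀ (a≡0⇒p+q*a≡0 A₀ (first k)
    (D-negative m k t k₁ k₂ k₃))
    (D-negative m k (t ℤ.- 1ℤ) k₁ k₂ k₃))
    -- `-[1+ k ] ℤ.- 1ℤ` computes to `-[1+ suc (k ℕ.+ 0) ]`, hence this form of the index.
    (D-negative m (suc (k ℕ.+ 0)) t k₁ k₂ k₃))
    (D-negative m (suc (k ℕ.+ 0)) (t ℤ.- 1ℤ) k₁ k₂ k₃)
  where
  open Coefficients (suc m) ℓ t k₁ k₂ k₃
  -- At ℓ = -1 the factor ℓ + 1 of A₊ vanishes instead of the residue.
  first : ∀ k → Coefficients.A₊ (suc m) -[1+ k ] t k₁ k₂ k₃ * D (suc m) (-[1+ k ] ℤ.+ 1ℤ) t k₁ k₂ k₃ ≡ 0ℚ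
  first zero    = ≡.trans (≡.cong (_* D (suc m) 0ℤ t k₁ k₂ k₃) (ℚ.*-zeroˡ bracket)) (ℚ.*-zeroˡ (D (suc m) 0ℤ t k₁ k₂ k₃))
    where
    bracket : ℚ
    bracket = ι (+ k₂ ℤ.- + k₁ ℤ.- + 3) + + k₃ ℚ./ 2 * ι (+ 2 ℤ.* + suc m ℤ.- + 2 ℤ.- -1ℤ)
  first (suc k) = ≡.trans (≡.cong (Coefficients.A₊ (suc m) -[1+ suc k ] t k₁ k₂ k₃ *_) (D-negative m k t k₁ k₂ k₃))
    (ℚ.*-zeroʳ (Coefficients.A₊ (suc m) -[1+ suc k ] t k₁ k₂ k₃))
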